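{- The set $I^{\forall^\infty}_{TD^+} = \{e : (\forall^\infty L \in \mathcal L_e)[\mathrm{TD}^+(L,\mathcal L_e) < \infty]\}$ is $\Sigma^0_5$-complete.
   Context: $W_0,W_1,\ldots$ is an acceptable numbering of all r.e. subsets of $\mathbb N$; $L^e_j = \{x : \langle j,x\rangle \in W_e\}$ and $\mathcal L_e = \{L^e_j : j\in\mathbb N\}$. $\forall^\infty$ means "for all but finitely many". For a family $\mathcal L$ of subsets of $\mathbb N$ and $L\in\mathcal L$, a positive teaching set for $L$ w.r.t. $\mathcal L$ is a set $S\subseteq L$ such that no $L'\in\mathcal L\setminus\{L\}$ satisfies $S\subseteq L'$; $\mathrm{TD}^+(L,\mathcal L)$ is the smallest size of such a set ($\infty$ if there is no finite one). $\Sigma^0_n$-complete means definable by a $\Sigma^0_n$ formula and every $\Sigma^0_n$ set many-one reduces to it via a recursive function. -}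

module Defs where

open import Data.Nat using (ℕ; zero; suc; _+_)
open import Data.Product using (Σ; ∃; _×_; _,_; proj₁; proj₂)
open import Data.List using (List)
open import Data.List.Relation.Unary.All using (All)
open import Data.List.Relation.Unary.Any using (Any)
open import Relation.Binary.PropositionalEquality using (_≡_)
open import Relation.Nullary using (¬_)
open import Data.Empty using (⊥)
open import Level using (Lift; 0ℓ) renaming (suc to lsuc)

tri : ℕ → ℕ
tri zero    = zero
tri (suc k) = suc k + tri k

pair : ℕ → ℕ → ℕ
pair x y = tri (x + y) + y

-- inverse of pair, by walking along the diagonals
unpair : ℕ → ℕ × ℕ
unpair zero = 0 , 0
unpair (suc n) with unpair n
... | zero  , y = suc y , 0
... | suc x , y = x , suc y

fst snd : ℕ → ℕ
fst n = proj₁ (unpair n)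
snd n = proj₂ (unpair n)

data Code : Set where
  zeroC succC idC leftC rightC : Code
  compC  : Code → Code → Code
  pairC  : Code → Code → Code
  precC  : Code → Code → Code
  muC    : Code → Code

data Eval : Code → ℕ → ℕ → Set
data PRec (f g : Code) (x : ℕ) : ℕ → ℕ → Set
data Mu (f : Code) (x : ℕ) : ℕ → ℕ → Set

data Eval where
  ezero  : ∀ {x} → Eval zeroC x 0
  esucc  : ∀ {x} → Eval succC x (suc x)
  eid    : ∀ {x} → Eval idC x x
  eleft  : ∀ {x} → Eval leftC x (fst x)
  eright : ∀ {x} → Eval rightC x (snd x)
  ecomp  : ∀ {f g x y z} → Eval g x y → Eval f y z → Eval (compC f g) x z
  epair  : ∀ {f g x y z} → Eval f x y → Eval g x z → Eval (pairC f g) x (pair y z)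
  eprec  : ∀ {f g x v} → PRec f g (fst x) (snd x) v → Eval (precC f g) x v
  emu    : ∀ {f x v} → Mu f x 0 v → Eval (muC f) x v

data PRec f g x where
  pz : ∀ {v} → Eval f x v → PRec f g x 0 v
  ps : ∀ {y w v} → PRec f g x y w → Eval g (pair (pair x y) w) v → PRec f g x (suc y) v

data Mu f x where
  found : ∀ {k} → Eval f (pair x k) 0 → Mu f x k k
  next  : ∀ {k m y} → Eval f (pair x k) (suc m) → Mu f x (suc k) y → Mu f x k y

decode′ : ℕ → ℕ → Code
decode′ zero _ = zeroC
decode′ (suc fuel) n with unpair n
... | 0 , r = zeroC
... | 1 , r = succC
... | 2 , r = idC
... | 3 , r = leftC
... | 4 , r = rightC
... | 5 , r = compC (decode′ fuel (fst r)) (decode′ fuel (snd r))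
... | 6 , r = pairC (decode′ fuel (fst r)) (decode′ fuel (snd r))
... | 7 , r = precC (decode′ fuel (fst r)) (decode′ fuel (snd r))
... | 8 , r = muC (decode′ fuel r)
... | _ , r = zeroC

decode : ℕ → Code
decode e = decode′ (suc e) e

Pred : Set₁
Pred = ℕ → Set

_≐_ : Pred → Pred → Set
A ≐ B = ∀ x → (A x → B x) × (B x → A x)

_⇔_ : Set → Set → Set
P ⇔ Q = (P → Q) × (Q → P)

W : ℕ → Pred
W e x = ∃ λ v → Eval (decode e) x v

L : ℕ → ℕ → Pred
L e j x = W e (pair j x)

_⊆ₗ_ : List ℕ → Pred → Set
S ⊆ₗ A = All A S

IsPosTeachingSet : ℕ → ℕ → List ℕ → Set
IsPosTeachingSet e j S =
  (S ⊆ₗ L e j) × ¬ (∃ λ k → ¬ (L e k ≐ L e j) × (S ⊆ₗ L e k))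

TD⁺Finite : ℕ → ℕ → Set
TD⁺Finite e j = ∃ λ S → IsPosTeachingSet e j S

-- (∀^∞ L ∈ 𝓛_e) P(L): all but finitely many members L of 𝓛_e satisfy P,
-- i.e. every member failing P is among finitely many members L^e_{k}, k ∈ F.
AlmostAllMembers : ℕ → (ℕ → Set) → Set
AlmostAllMembers e P =
  ∃ λ (F : List ℕ) → ∀ j → ¬ P j → Any (λ k → L e j ≐ L e k) F

I-TD⁺ : Pred
I-TD⁺ e = AlmostAllMembers e (TD⁺Finite e)

Computable : (ℕ → ℕ) → Set
Computable f = ∃ λ c → ∀ x → Eval (decode c) x (f x)

Recursive : Pred → Set
Recursive A = ∃ λ (χ : ℕ → ℕ) → Computable χ × (∀ x → A x ⇔ (χ x ≡ 0))

mutual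
  Sigma : ℕ → Pred → Set₁
  Sigma zero    A = Lift (lsuc 0ℓ) (Recursive A)
  Sigma (suc n) A = Σ Pred λ B → Pi n B × (∀ x → A x ⇔ (∃ λ y → B (pair x y)))

  Pi : ℕ → Pred → Set₁
  Pi zero    A = Lift (lsuc 0ℓ) (Recursive A)
  Pi (suc n) A = Σ Pred λ B → Sigma n B × (∀ x → A x ⇔ (∀ y → B (pair x y)))

_≤m_ : Pred → Pred → Set
B ≤m A = ∃ λ f → Computable f × (∀ x → B x ⇔ A (f x))

SigmaComplete : ℕ → Pred → Set₁
SigmaComplete n A = Sigma n A × (∀ B → Sigma n B → B ≤m A)

{-# OPTIONS --safe #-}
module Submission where

-- Upper bound: replacing the finite sets of exceptions and of examples by bounds, e lies in
-- the set iff there is N such that every j either equals some member with index below N or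
-- has a stage t such that the part of L^e_j seen by stage t is contained in no other member.
-- As equality of members is Π₂, this is a Σ₅ condition once the halting of code e at x
-- within s steps is seen to be recursive, which takes a universal machine.
--
-- Hardness: a Σ₅ condition ∃ a. ∀ b. φ a b with φ in Σ₃ holds iff the search for such an a
-- has only finitely many records ending before an increase of a.  Being a record is Π₃.  For
-- every number n there is a block of languages that contains exactly one language without a
-- finite positive teaching set if n is a record, and none otherwise.

open import Defs
open import Level using (0ℓ; lift)
open import Axiom.ExcludedMiddle using (ExcludedMiddle)
open import Data.Nat
open import Data.Nat.Properties
open import Data.Fin using (Fin; zero; suc)
open import Data.Vec using (Vec; []; _∷_; lookup)
open import Data.List using (List; []; _∷_; filter; map; upTo)
open import Data.Nat.ListAction using (sum)
open import Data.List.Membership.Propositional using (_∈_; find; lose)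
open import Data.List.Membership.Propositional.Properties using (∈-filter⁺; ∈-filter⁻; ∈-upTo⁺; ∈-map⁺)
open import Data.List.Relation.Unary.All as All using (All; []; _∷_)
open import Data.List.Relation.Unary.Any using (Any; here; there)
open import Data.Product using (∃; _×_; _,_; proj₁; proj₂)
open import Data.Sum using (_⊎_; inj₁; inj₂)
open import Data.Empty using (⊥)
open import Relation.Nullary using (¬_; yes; no; contradiction)
open import Relation.Binary.PropositionalEquality

-- The obstacle in the hardness proof is to trade the leading `∃ a` for a finiteness statement.
-- Counting failing pairs (a, b) does not work: one wrong `a` may fail at infinitely many `b`
-- although a later `a` is right. So the search leaves `a` at its first failing `b`. To say that
-- this `b` is the first involves Σ₃ statements about the earlier values, whereas being a record has
-- to be Π₃. Hence a record stores for each earlier `b` the least witness `c` of its Σ₃ statement.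
-- The claim about a given `c` only combines a Π₂ statement with Σ₂ ones, and since the least
-- witness is unique, the choice of witnesses does not multiply the records.
--
-- A block of languages can test a Π₃ property because having no finite teaching set is of that
-- kind: for every bound `k` on the examples there is a rival language that agrees with the main one
-- up to `k`. The rival for `k` collapses onto the main language exactly if some number up to `k`
-- codes a refutation of the record.

-- The pairing function and its inverse

pair-suc : ∀ x y → pair x (suc y) ≡ suc (pair (suc x) y)
pair-suc x y rewrite +-suc x y = +-suc (tri (suc (x + y))) y

pair-suc-0 : ∀ x → pair (suc x) 0 ≡ suc (pair 0 x)
pair-suc-0 x rewrite +-identityʳ x | +-identityʳ (x + tri x) = cong suc (+-comm x (tri x))

-- Induction on the code retraces the diagonal walk of `unpair`. With `pair x y ≡ n` as a
-- hypothesis, the recursive call may go to the preceding pair on the walk.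
unpair-unique : ∀ n x y → pair x y ≡ n → unpair n ≡ (x , y)
unpair-unique zero zero zero _ = refl
unpair-unique (suc n) (suc x) zero eq
  rewrite unpair-unique n 0 x (suc-injective (trans (sym (pair-suc-0 x)) eq)) = refl
unpair-unique (suc n) x (suc y) eq
  rewrite unpair-unique n (suc x) y (suc-injective (trans (sym (pair-suc x y)) eq)) = refl

fst-pair : ∀ x y → fst (pair x y) ≡ x
fst-pair x y = cong proj₁ (unpair-unique (pair x y) x y refl)

snd-pair : ∀ x y → snd (pair x y) ≡ y
snd-pair x y = cong proj₂ (unpair-unique (pair x y) x y refl)

pair-fst-snd : ∀ n → pair (fst n) (snd n) ≡ n
pair-fst-snd zero = refl
pair-fst-snd (suc n) with unpair n | pair-fst-snd n
... | zero  , y | eq = trans (pair-suc-0 y) (cong suc eq)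
... | suc x , y | eq = trans (pair-suc x y) (cong suc eq)

n≤tri : ∀ n → n ≤ tri n
n≤tri zero    = z≤n
n≤tri (suc n) = m≤m+n (suc n) (tri n)

x≤pair : ∀ x y → x ≤ pair x y
x≤pair x y = ≤-trans (m≤m+n x y) (≤-trans (n≤tri (x + y)) (m≤m+n (tri (x + y)) y))

y≤pair : ∀ x y → y ≤ pair x y
y≤pair x y = m≤n+m y (tri (x + y))

fst≤ : ∀ n → fst n ≤ n
fst≤ n = subst (fst n ≤_) (pair-fst-snd n) (x≤pair (fst n) (snd n))

snd≤ : ∀ n → snd n ≤ n
snd≤ n = subst (snd n ≤_) (pair-fst-snd n) (y≤pair (fst n) (snd n))

-- Composite programs have positive tags, so their payload is strictly smaller than their code. This
-- is why the fuel `suc e` in `decode` never runs out.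
snd< : ∀ n → 0 < fst n → snd n < n
snd< n 0<fst = subst (snd n <_) (pair-fst-snd n)
  (+-monoˡ-≤ (snd n) (≤-trans 0<fst (≤-trans (m≤m+n (fst n) (snd n)) (n≤tri (fst n + snd n)))))

-- Determinism of evaluation and the coding of programs by numbers

mutual
  Eval-functional : ∀ {c x v w} → Eval c x v → Eval c x w → v ≡ w
  Eval-functional ezero ezero = refl
  Eval-functional esucc esucc = refl
  Eval-functional eid eid = refl
  Eval-functional eleft eleft = refl
  Eval-functional eright eright = refl
  Eval-functional (ecomp p q) (ecomp p′ q′) with refl ← Eval-functional p p′ = Eval-functional q q′
  Eval-functional (epair p q) (epair p′ q′) = cong₂ pair (Eval-functional p p′) (Eval-functional q q′)
  Eval-functional (eprec p) (eprec p′) = PRec-functional p p′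
  Eval-functional (emu p) (emu p′) = Mu-functional p p′

  PRec-functional : ∀ {f g x n v w} → PRec f g x n v → PRec f g x n w → v ≡ w
  PRec-functional (pz p) (pz p′) = Eval-functional p p′
  PRec-functional (ps p q) (ps p′ q′) with refl ← PRec-functional p p′ = Eval-functional q q′

  Mu-functional : ∀ {f x k v w} → Mu f x k v → Mu f x k w → v ≡ w
  Mu-functional (found p) (found p′) = refl
  Mu-functional (found p) (next p′ _) with () ← Eval-functional p p′
  Mu-functional (next p _) (found p′) with () ← Eval-functional p p′
  Mu-functional (next _ p) (next _ p′) = Mu-functional p p′

-- The graph of decode, without its fuel: RepT t r c says that pair t r codes c.
data RepT : ℕ → ℕ → Code → Set

record Rep (n : ℕ) (c : Code) : Set where
  inductive
  constructor rep
  field tagged : RepT (fst n) (snd n) c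

data RepT where
  rzero  : ∀ {r} → RepT 0 r zeroC
  rsucc  : ∀ {r} → RepT 1 r succC
  rid    : ∀ {r} → RepT 2 r idC
  rleft  : ∀ {r} → RepT 3 r leftC
  rright : ∀ {r} → RepT 4 r rightC
  rcomp  : ∀ {r f g} → Rep (fst r) f → Rep (snd r) g → RepT 5 r (compC f g)
  rpair  : ∀ {r f g} → Rep (fst r) f → Rep (snd r) g → RepT 6 r (pairC f g)
  rprec  : ∀ {r f g} → Rep (fst r) f → Rep (snd r) g → RepT 7 r (precC f g)
  rmu    : ∀ {r f} → Rep r f → RepT 8 r (muC f)
  rjunk  : ∀ {t r} → RepT (9 + t) r zeroC

decode′-rep : ∀ fuel n → n < fuel → RepT (fst n) (snd n) (decode′ fuel n)
-- `snd< n` is abstracted along with `unpair n`, so that in a branch with a concrete tag it bounds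
-- the payload `r` of that branch.
decode′-rep (suc fuel) n (s≤s n≤fuel) with unpair n | snd< n
... | 0 , r | _ = rzero
... | 1 , r | _ = rsucc
... | 2 , r | _ = rid
... | 3 , r | _ = rleft
... | 4 , r | _ = rright
... | 5 , r | lt = rcomp (rep (decode′-rep fuel (fst r) (≤-<-trans (fst≤ r) (≤-trans (lt z<s) n≤fuel))))
                         (rep (decode′-rep fuel (snd r) (≤-<-trans (snd≤ r) (≤-trans (lt z<s) n≤fuel))))
... | 6 , r | lt = rpair (rep (decode′-rep fuel (fst r) (≤-<-trans (fst≤ r) (≤-trans (lt z<s) n≤fuel))))
                         (rep (decode′-rep fuel (snd r) (≤-<-trans (snd≤ r) (≤-trans (lt z<s) n≤fuel))))
... | 7 , r | lt = rprec (rep (decode′-rep fuel (fst r) (≤-<-trans (fst≤ r) (≤-trans (lt z<s) n≤fuel))))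
                         (rep (decode′-rep fuel (snd r) (≤-<-trans (snd≤ r) (≤-trans (lt z<s) n≤fuel))))
... | 8 , r | lt = rmu (rep (decode′-rep fuel r (≤-trans (lt z<s) n≤fuel)))
... | suc (suc (suc (suc (suc (suc (suc (suc (suc t)))))))) , r | _ = rjunk

decode-rep : ∀ n → Rep n (decode n)
decode-rep n = rep (decode′-rep (suc n) n ≤-refl)

mutual
  Rep-functional : ∀ {n c d} → Rep n c → Rep n d → c ≡ d
  Rep-functional (rep p) (rep q) = RepT-functional p q

  RepT-functional : ∀ {t r c d} → RepT t r c → RepT t r d → c ≡ d
  RepT-functional rzero rzero = refl
  RepT-functional rsucc rsucc = refl
  RepT-functional rid rid = refl
  RepT-functional rleft rleft = refl
  RepT-functional rright rright = refl
  RepT-functional rjunk rjunk = refl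
  RepT-functional (rcomp p q) (rcomp p′ q′) = cong₂ compC (Rep-functional p p′) (Rep-functional q q′)
  RepT-functional (rpair p q) (rpair p′ q′) = cong₂ pairC (Rep-functional p p′) (Rep-functional q q′)
  RepT-functional (rprec p q) (rprec p′ q′) = cong₂ precC (Rep-functional p p′) (Rep-functional q q′)
  RepT-functional (rmu p) (rmu p′) = cong muC (Rep-functional p p′)

rep⇒decode : ∀ {n c} → Rep n c → decode n ≡ c
rep⇒decode {n} p = Rep-functional (decode-rep n) p

Rep-pair : ∀ t r {c} → RepT t r c → Rep (pair t r) c
Rep-pair t r {c} p = rep (subst₂ (λ t r → RepT t r c) (sym (fst-pair t r)) (sym (snd-pair t r)) p)

Rep-fst : ∀ m n {c} → Rep m c → Rep (fst (pair m n)) c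
Rep-fst m n {c} = subst (λ k → Rep k c) (sym (fst-pair m n))

Rep-snd : ∀ m n {c} → Rep n c → Rep (snd (pair m n)) c
Rep-snd m n {c} = subst (λ k → Rep k c) (sym (snd-pair m n))

rep-comp : ∀ {m n f g} → Rep m f → Rep n g → Rep (pair 5 (pair m n)) (compC f g)
rep-comp {m} {n} p q = Rep-pair 5 (pair m n) (rcomp (Rep-fst m n p) (Rep-snd m n q))

rep-pair : ∀ {m n f g} → Rep m f → Rep n g → Rep (pair 6 (pair m n)) (pairC f g)
rep-pair {m} {n} p q = Rep-pair 6 (pair m n) (rpair (Rep-fst m n p) (Rep-snd m n q))

rep-prec : ∀ {m n f g} → Rep m f → Rep n g → Rep (pair 7 (pair m n)) (precC f g)
rep-prec {m} {n} p q = Rep-pair 7 (pair m n) (rprec (Rep-fst m n p) (Rep-snd m n q))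

-- Abstract, since evaluating the unary code of a concrete program is hopeless.
abstract
  encode : ∀ c → ∃ λ n → Rep n c
  encode zeroC  = pair 0 0 , Rep-pair 0 0 rzero
  encode succC  = pair 1 0 , Rep-pair 1 0 rsucc
  encode idC    = pair 2 0 , Rep-pair 2 0 rid
  encode leftC  = pair 3 0 , Rep-pair 3 0 rleft
  encode rightC = pair 4 0 , Rep-pair 4 0 rright
  encode (compC f g) = _ , rep-comp (proj₂ (encode f)) (proj₂ (encode g))
  encode (pairC f g) = _ , rep-pair (proj₂ (encode f)) (proj₂ (encode g))
  encode (precC f g) = _ , rep-prec (proj₂ (encode f)) (proj₂ (encode g))
  encode (muC f) with m , p ← encode f = pair 8 m , Rep-pair 8 m (rmu p)

-- A language of recursive expressions and its compiler

Fun : ℕ → Set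
Fun zero    = ℕ
Fun (suc n) = ℕ → Fun n

apply : ∀ {n} → Fun n → Vec ℕ n → ℕ
apply f []       = f
apply f (x ∷ xs) = apply (f x) xs

-- The head of an environment is its outermost right component, which matches the
-- arguments pair (pair x i) w that precC passes to its step.
env : ∀ {n} → Vec ℕ n → ℕ
env []       = 0
env (x ∷ xs) = pair (env xs) x

Comp : ∀ n → Fun n → Set
Comp n f = ∃ λ c → ∀ ρ → Eval c (env ρ) (apply f ρ)

ifz : ∀ {A : Set} → ℕ → A → A → A
ifz zero    a b = a
ifz (suc _) a b = b

natrec : ℕ → (ℕ → ℕ → ℕ) → ℕ → ℕ
natrec z s zero    = z
natrec z s (suc n) = s n (natrec z s n)

-- A function is shown recursive by an expression with the same meaning, mostly by `refl`. `call`
-- admits any total function that already has a program, so the language is not confined to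
-- primitive recursion.
data Exp (n : ℕ) : Set where
  var      : Fin n → Exp n
  lit      : ℕ → Exp n
  suc′     : Exp n → Exp n
  pair′    : Exp n → Exp n → Exp n
  fst′ snd′ : Exp n → Exp n
  ifz′     : Exp n → Exp n → Exp n → Exp n
  rec′     : Exp n → Exp (2 + n) → Exp n → Exp n
  call     : ∀ {k f} → Comp k f → Vec (Exp n) k → Exp n

mutual
  ⟦_⟧ : ∀ {n} → Exp n → Vec ℕ n → ℕ
  ⟦ var i ⟧ ρ = lookup ρ i
  ⟦ lit k ⟧ ρ = k
  ⟦ suc′ e ⟧ ρ = suc (⟦ e ⟧ ρ)
  ⟦ pair′ d e ⟧ ρ = pair (⟦ d ⟧ ρ) (⟦ e ⟧ ρ)
  ⟦ fst′ e ⟧ ρ = fst (⟦ e ⟧ ρ)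
  ⟦ snd′ e ⟧ ρ = snd (⟦ e ⟧ ρ)
  ⟦ ifz′ e a b ⟧ ρ = ifz (⟦ e ⟧ ρ) (⟦ a ⟧ ρ) (⟦ b ⟧ ρ)
  ⟦ rec′ z s e ⟧ ρ = natrec (⟦ z ⟧ ρ) (λ i w → ⟦ s ⟧ (w ∷ i ∷ ρ)) (⟦ e ⟧ ρ)
  ⟦ call {f = f} _ es ⟧ ρ = apply f (⟦ es ⟧* ρ)

  ⟦_⟧* : ∀ {n k} → Vec (Exp n) k → Vec ℕ n → Vec ℕ k
  ⟦ [] ⟧* ρ = []
  ⟦ e ∷ es ⟧* ρ = ⟦ e ⟧ ρ ∷ ⟦ es ⟧* ρ

constC : ℕ → Code
constC zero    = zeroC
constC (suc k) = compC succC (constC k)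

mutual
  compile : ∀ {n} → Exp n → Code
  compile (var zero)    = rightC
  compile (var (suc i)) = compC (compile (var i)) leftC
  compile (lit k) = constC k
  compile (suc′ e) = compC succC (compile e)
  compile (pair′ d e) = pairC (compile d) (compile e)
  compile (fst′ e) = compC leftC (compile e)
  compile (snd′ e) = compC rightC (compile e)
  -- The codes have no conditional. A recursion on the tested value starts from `a`, and each of its
  -- steps discards the previous value and returns `b`; `compC leftC leftC` recovers the
  -- environment.
  compile (ifz′ e a b) =
    compC (precC (compile a) (compC (compile b) (compC leftC leftC))) (pairC idC (compile e))
  compile (rec′ z s e) = compC (precC (compile z) (compile s)) (pairC idC (compile e))
  compile (call (c , _) es) = compC c (compile* es)

  compile* : ∀ {n k} → Vec (Exp n) k → Code
  compile* []       = zeroC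
  compile* (e ∷ es) = pairC (compile* es) (compile e)

const-eval : ∀ k {x} → Eval (constC k) x k
const-eval zero    = ezero
const-eval (suc k) = ecomp (const-eval k) esucc

left-eval : ∀ x y → Eval leftC (pair x y) x
left-eval x y = subst (Eval leftC (pair x y)) (fst-pair x y) eleft

right-eval : ∀ x y → Eval rightC (pair x y) y
right-eval x y = subst (Eval rightC (pair x y)) (snd-pair x y) eright

prec-eval : ∀ {f g n v} x → PRec f g x n v → Eval (precC f g) (pair x n) v
prec-eval {f} {g} {n} {v} x p =
  eprec (subst₂ (λ x n → PRec f g x n v) (sym (fst-pair x n)) (sym (snd-pair x n)) p)

mutual
  compile-eval : ∀ {n} (e : Exp n) ρ → Eval (compile e) (env ρ) (⟦ e ⟧ ρ)
  compile-eval (var zero)    (x ∷ ρ) = right-eval (env ρ) x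
  compile-eval (var (suc i)) (x ∷ ρ) = ecomp (left-eval (env ρ) x) (compile-eval (var i) ρ)
  compile-eval (lit k) ρ = const-eval k
  compile-eval (suc′ e) ρ = ecomp (compile-eval e ρ) esucc
  compile-eval (pair′ d e) ρ = epair (compile-eval d ρ) (compile-eval e ρ)
  compile-eval (fst′ e) ρ = ecomp (compile-eval e ρ) eleft
  compile-eval (snd′ e) ρ = ecomp (compile-eval e ρ) eright
  compile-eval (ifz′ e a b) ρ =
    ecomp (epair eid (compile-eval e ρ)) (prec-eval (env ρ) (branch (⟦ e ⟧ ρ)))
    where
      branch : ∀ k → PRec (compile a) (compC (compile b) (compC leftC leftC)) (env ρ) k
                          (ifz k (⟦ a ⟧ ρ) (⟦ b ⟧ ρ))
      branch zero    = pz (compile-eval a ρ)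
      branch (suc k) = ps (branch k)
        (ecomp (ecomp (left-eval _ (ifz k (⟦ a ⟧ ρ) (⟦ b ⟧ ρ))) (left-eval (env ρ) k)) (compile-eval b ρ))
  compile-eval (rec′ z s e) ρ =
    ecomp (epair eid (compile-eval e ρ)) (prec-eval (env ρ) (loop (⟦ e ⟧ ρ)))
    where
      loop : ∀ k → PRec (compile z) (compile s) (env ρ) k
                        (natrec (⟦ z ⟧ ρ) (λ i w → ⟦ s ⟧ (w ∷ i ∷ ρ)) k)
      loop zero    = pz (compile-eval z ρ)
      loop (suc k) = ps (loop k) (compile-eval s (_ ∷ k ∷ ρ))
  compile-eval (call (_ , p) es) ρ = ecomp (compile*-eval es ρ) (p (⟦ es ⟧* ρ))

  compile*-eval : ∀ {n k} (es : Vec (Exp n) k) ρ → Eval (compile* es) (env ρ) (env (⟦ es ⟧* ρ))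
  compile*-eval []       ρ = ezero
  compile*-eval (e ∷ es) ρ = epair (compile*-eval es ρ) (compile-eval e ρ)

by : ∀ {n f} (e : Exp n) → (∀ ρ → ⟦ e ⟧ ρ ≡ apply f ρ) → Comp n f
by e eq = compile e , λ ρ → subst (Eval (compile e) (env ρ)) (eq ρ) (compile-eval e ρ)

Comp⇒Computable : ∀ {f} → Comp 1 f → Computable f
-- `pairC zeroC idC` turns `x` into the environment `pair 0 x` of one variable.
Comp⇒Computable {f} (c , p) with m , q ← encode (compC c (pairC zeroC idC)) =
  m , λ x → subst (λ d → Eval d x (f x)) (sym (rep⇒decode q)) (ecomp (epair ezero eid) (p (x ∷ [])))

Computable⇒Comp : ∀ {f} → Computable f → Comp 1 f
Computable⇒Comp (c , p) = compC (decode c) rightC , λ { (x ∷ []) → ecomp (right-eval 0 x) (p x) }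

pattern #0 = var zero
pattern #1 = var (suc zero)
pattern #2 = var (suc (suc zero))
pattern #3 = var (suc (suc (suc zero)))
pattern #4 = var (suc (suc (suc (suc zero))))
pattern #5 = var (suc (suc (suc (suc (suc zero)))))
pattern #6 = var (suc (suc (suc (suc (suc (suc zero))))))

pred-comp : Comp 1 pred
pred-comp = by (rec′ (lit 0) #1 #0) λ { (zero ∷ []) → refl ; (suc n ∷ []) → refl }

+-comp : Comp 2 _+_
+-comp = by (rec′ #1 (suc′ #0) #0) λ { (m ∷ n ∷ []) → lemma m n }
  where
    lemma : ∀ m n → natrec n (λ _ w → suc w) m ≡ m + n
    lemma zero    n = refl
    lemma (suc m) n = cong suc (lemma m n)

*-comp : Comp 2 _*_
*-comp = by (rec′ (lit 0) (call +-comp (#3 ∷ #0 ∷ [])) #0) λ { (m ∷ n ∷ []) → lemma m n }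
  where
    lemma : ∀ m n → natrec 0 (λ _ w → n + w) m ≡ m * n
    lemma zero    n = refl
    lemma (suc m) n = cong (n +_) (lemma m n)

∸-comp : Comp 2 _∸_
∸-comp = by (rec′ #0 (call pred-comp (#0 ∷ [])) #1) λ { (m ∷ n ∷ []) → lemma m n }
  where
    lemma : ∀ m n → natrec m (λ _ w → pred w) n ≡ m ∸ n
    lemma m zero    = refl
    lemma m (suc n) = trans (cong pred (lemma m n)) (pred[m∸n]≡m∸[1+n] m n)

infixl 6 _+′_ _∸′_
infixl 7 _*′_

_+′_ _*′_ _∸′_ : ∀ {n} → Exp n → Exp n → Exp n
d +′ e = call +-comp (d ∷ e ∷ [])
d *′ e = call *-comp (d ∷ e ∷ [])
d ∸′ e = call ∸-comp (d ∷ e ∷ [])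

pred′ : ∀ {n} → Exp n → Exp n
pred′ e = call pred-comp (e ∷ [])

cong₃ : ∀ {A B C : Set} {d} {D : Set d} (f : A → B → C → D) {x x′ y y′ z z′} →
        x ≡ x′ → y ≡ y′ → z ≡ z′ → f x y z ≡ f x′ y′ z′
cong₃ f refl refl refl = refl

-- Universal machine

switch : ℕ → List ℕ → ℕ → ℕ
switch t []       d = d
switch t (a ∷ as) d = ifz t a (switch (pred t) as d)

-- A stack machine on numbers, whose states evaluate a code or return a value to a stack of
-- frames; the empty stack is 0, whose tag is 0.
--
-- The pairing is abstract here, so that the equations of the machine are checked without
-- unfolding it.
module Machine
  (pair : ℕ → ℕ → ℕ) (fst snd : ℕ → ℕ) (fst-0 : fst 0 ≡ 0)
  (fst-pair : ∀ x y → fst (pair x y) ≡ x) (snd-pair : ∀ x y → snd (pair x y) ≡ y)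
  where

  opaque
    ret : ℕ → ℕ → ℕ
    ret v K = pair 0 (pair v K)

    ev : ℕ → ℕ → ℕ → ℕ
    ev c x K = pair 1 (pair c (pair x K))

    frame : ℕ → ℕ → ℕ → ℕ
    frame t d K = pair t (pair d K)

    pairFrame : ℕ → ℕ → ℕ → ℕ
    pairFrame g x = frame 2 (pair g x)

    -- r counts the iterations left.
    precFrame : ℕ → ℕ → ℕ → ℕ → ℕ → ℕ
    precFrame g x i r = frame 4 (pair (pair g x) (pair i r))

    muFrame : ℕ → ℕ → ℕ → ℕ → ℕ
    muFrame f x k = frame 5 (pair (pair f x) k)

  composeFrame : ℕ → ℕ → ℕ
  composeFrame f = frame 1 f

  pairedFrame : ℕ → ℕ → ℕ
  pairedFrame v = frame 3 v

  precStep : ℕ → ℕ → ℕ → ℕ → ℕ → ℕ → ℕ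
  precStep v g x i r K = ifz r (ret v K) (ev g (pair (pair x i) v) (precFrame g x (suc i) (pred r) K))

  muStep : ℕ → ℕ → ℕ → ℕ → ℕ → ℕ
  muStep v f x k K = ifz v (ret k K) (ev f (pair x (suc k)) (muFrame f x (suc k) K))

  evStep : ℕ → ℕ → ℕ → ℕ → ℕ
  evStep t r x K = switch t
    ( ret 0 K
    ∷ ret (suc x) K
    ∷ ret x K
    ∷ ret (fst x) K
    ∷ ret (snd x) K
    ∷ ev (snd r) x (composeFrame (fst r) K)
    ∷ ev (fst r) x (pairFrame (snd r) x K)
    ∷ ev (fst r) (fst x) (precFrame (snd r) (fst x) 0 (snd x) K)
    ∷ ev r (pair x 0) (muFrame r x 0 K)
    ∷ []) (ret 0 K)

  retStep : ℕ → ℕ → ℕ → ℕ → ℕ → ℕ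
  retStep s v t d K = switch t
    ( s
    ∷ ev d v K
    ∷ ev (fst d) (snd d) (pairedFrame v K)
    ∷ ret (pair d v) K
    ∷ precStep v (fst (fst d)) (snd (fst d)) (fst (snd d)) (snd (snd d)) K
    ∷ []) (muStep v (fst (fst d)) (snd (fst d)) (snd d) K)

  step : ℕ → ℕ
  step s = ifz (fst s)
    (retStep s (fst (snd s)) (fst (snd (snd s))) (fst (snd (snd (snd s)))) (snd (snd (snd (snd s)))))
    (evStep (fst (fst (snd s))) (snd (fst (snd s))) (fst (snd (snd s))) (snd (snd (snd s))))

  run : ℕ → ℕ → ℕ
  run zero    s = s
  run (suc n) s = run n (step s)

  -- The first summand is the tag of the state. For a returning state the second is the tag of the
  -- top frame, which is positive for every frame the machine pushes. So zero means a value returned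
  -- to the empty stack.
  haltTest : ℕ → ℕ
  haltTest s = fst s + fst (snd (snd s))

  Halted : ℕ → Set
  Halted s = haltTest s ≡ 0

  opaque
    unfolding ret ev frame pairFrame precFrame muFrame

    step-ev : ∀ c x K → step (ev c x K) ≡ evStep (fst c) (snd c) x K
    step-ev c x K = trans
      (cong₃ (λ t u w → ifz t
               (retStep s u (fst w) (fst (snd w)) (snd (snd w)))
               (evStep (fst u) (snd u) (fst w) (snd w)))
             (fst-pair 1 p) (trans (cong fst eq) (fst-pair c q)) (trans (cong snd eq) (snd-pair c q)))
      (cong₂ (evStep (fst c) (snd c)) (fst-pair x K) (snd-pair x K))
      where
        s p q : ℕ
        s = ev c x K
        p = pair c (pair x K)
        q = pair x K
        eq : snd s ≡ p
        eq = snd-pair 1 p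

    step-ret : ∀ v K → step (ret v K) ≡ retStep (ret v K) v (fst K) (fst (snd K)) (snd (snd K))
    step-ret v K =
      cong₃ (λ t u w → ifz t
              (retStep s u (fst w) (fst (snd w)) (snd (snd w)))
              (evStep (fst u) (snd u) (fst w) (snd w)))
            (fst-pair 0 p) (trans (cong fst eq) (fst-pair v K)) (trans (cong snd eq) (snd-pair v K))
      where
        s p : ℕ
        s = ret v K
        p = pair v K
        eq : snd s ≡ p
        eq = snd-pair 0 p

    step-frame : ∀ v t d K → step (ret v (frame t d K)) ≡ retStep (ret v (frame t d K)) v t d K
    step-frame v t d K = trans (step-ret v (frame t d K))
      (cong₃ (retStep (ret v (frame t d K)) v)
        (fst-pair t (pair d K))
        (trans (cong fst (snd-pair t (pair d K))) (fst-pair d K))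
        (trans (cong snd (snd-pair t (pair d K))) (snd-pair d K)))

    step-pairFrame : ∀ v g x K → step (ret v (pairFrame g x K)) ≡ ev g x (pairedFrame v K)
    step-pairFrame v g x K = trans (step-frame v 2 (pair g x) K)
      (cong₂ (λ g x → ev g x (pairedFrame v K)) (fst-pair g x) (snd-pair g x))

    step-precFrame : ∀ v g x i r K → step (ret v (precFrame g x i r K)) ≡ precStep v g x i r K
    step-precFrame v g x i r K = trans (step-frame v 4 (pair p q) K) (trans
      (cong₂ (λ p q → precStep v (fst p) (snd p) (fst q) (snd q) K) (fst-pair p q) (snd-pair p q))
      (trans (cong₂ (λ g x → precStep v g x (fst q) (snd q) K) (fst-pair g x) (snd-pair g x))
             (cong₂ (λ i r → precStep v g x i r K) (fst-pair i r) (snd-pair i r))))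
      where
        p q : ℕ
        p = pair g x
        q = pair i r

    step-muFrame : ∀ v f x k K → step (ret v (muFrame f x k K)) ≡ muStep v f x k K
    step-muFrame v f x k K = trans (step-frame v 5 (pair p k) K) (trans
      (cong₂ (λ p k → muStep v (fst p) (snd p) k K) (fst-pair p k) (snd-pair p k))
      (cong₂ (λ f x → muStep v f x k K) (fst-pair f x) (snd-pair f x)))
      where
        p : ℕ
        p = pair f x

    running-ev : ∀ c x K → ¬ Halted (ev c x K)
    running-ev c x K h with () ← trans (sym (fst-pair 1 (pair c (pair x K)))) (m+n≡0⇒m≡0 _ h)

    running-frame : ∀ v t d K → ¬ Halted (ret v (frame (suc t) d K))
    running-frame v t d K h = contradiction (trans (sym tag) (m+n≡0⇒n≡0 (fst (ret v F)) h)) λ ()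
      where
        F : ℕ
        F = frame (suc t) d K
        tag : fst (snd (snd (ret v F))) ≡ suc t
        tag = trans (cong fst (trans (cong snd (snd-pair 0 (pair v F))) (snd-pair v F)))
                    (fst-pair (suc t) (pair d K))

    running-pairFrame : ∀ v g x K → ¬ Halted (ret v (pairFrame g x K))
    running-pairFrame v g x K = running-frame v 1 (pair g x) K

    running-precFrame : ∀ v g x i r K → ¬ Halted (ret v (precFrame g x i r K))
    running-precFrame v g x i r K = running-frame v 3 (pair (pair g x) (pair i r)) K

    running-muFrame : ∀ v f x k K → ¬ Halted (ret v (muFrame f x k K))
    running-muFrame v f x k K = running-frame v 4 (pair (pair f x) k) K

    halted-ret : ∀ v → Halted (ret v 0)
    halted-ret v = cong₂ _+_ (fst-pair 0 (pair v 0))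
      (trans (cong fst (trans (cong snd (snd-pair 0 (pair v 0))) (snd-pair v 0))) fst-0)

  step-halted : ∀ s → Halted s → step s ≡ s
  step-halted s h rewrite m+n≡0⇒m≡0 (fst s) h | m+n≡0⇒n≡0 (fst s) h = refl

  run-halted : ∀ n {s} → Halted s → run n s ≡ s
  run-halted zero    h = refl
  run-halted (suc n) {s} h rewrite step-halted s h = run-halted n h

  run-+ : ∀ m n s → run (m + n) s ≡ run n (run m s)
  run-+ zero    n s = refl
  run-+ (suc m) n s = run-+ m n (step s)

  run-suc : ∀ n s → run (suc n) s ≡ step (run n s)
  run-suc zero    s = refl
  run-suc (suc n) s = run-suc n (step s)

open Machine pair fst snd refl fst-pair snd-pair

infix 4 _↦_
data _↦_ : ℕ → ℕ → Set where
  stop : ∀ {s} → s ↦ s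
  more : ∀ {s t u} → step s ≡ t → t ↦ u → s ↦ u

infixr 5 _⨾_
_⨾_ : ∀ {s t u} → s ↦ t → t ↦ u → s ↦ u
stop ⨾ q = q
more e p ⨾ q = more e (p ⨾ q)

mutual
  -- Quantifying over the stack makes the induction on derivations work: each premise is run below
  -- one more frame, and that frame resumes the run once the value returns.
  complete : ∀ {c D x v} → Rep c D → Eval D x v → ∀ K → ev c x K ↦ ret v K
  complete {c} {x = x} (rep p) q K = more (step-ev c x K) (completeT p q K)

  completeT : ∀ {t r D x v} → RepT t r D → Eval D x v → ∀ K → evStep t r x K ↦ ret v K
  completeT rzero ezero K = stop
  completeT rjunk ezero K = stop
  completeT rsucc esucc K = stop
  completeT rid eid K = stop
  completeT rleft eleft K = stop
  completeT rright eright K = stop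
  completeT {r = r} {v = v} (rcomp {f = f} p q) (ecomp {y = y} d e) K =
    complete q d (composeFrame (fst r) K) ⨾ more (step-frame y 1 (fst r) K) (complete p e K)
  completeT {r = r} {x = x} (rpair p q) (epair {y = y} {z = z} d e) K =
    complete p d (pairFrame (snd r) x K) ⨾ more (step-pairFrame y (snd r) x K)
      (complete q e (pairedFrame y K) ⨾ more (step-frame z 3 y K) stop)
  completeT {r = r} {x = x} {v} (rprec p q) (eprec d) K =
    subst (λ n → ev (fst r) (fst x) (precFrame (snd r) (fst x) 0 n K) ↦ ret v (precFrame (snd r) (fst x) (snd x) 0 K))
          (+-identityʳ (snd x)) (complete-prec p q d 0 K)
    ⨾ more (step-precFrame v (snd r) (fst x) (snd x) 0 K) stop
  completeT (rmu p) (emu d) K = complete-mu p d K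

  -- A derivation for `i` iterations uses up `i` of the `i + r` iterations with which the frame
  -- starts. Its premise leaves one more to do, so `r` has to vary.
  complete-prec : ∀ {a b f g x i w} → Rep a f → Rep b g → PRec f g x i w → ∀ r K →
                  ev a x (precFrame b x 0 (i + r) K) ↦ ret w (precFrame b x i r K)
  complete-prec {b = b} {x = x} p q (pz d) r K = complete p d (precFrame b x 0 r K)
  complete-prec {a} {b} {x = x} {w = w} p q (ps {y = i} {w = u} d e) r K =
    subst (λ n → ev a x (precFrame b x 0 n K) ↦ ret u (precFrame b x i (suc r) K))
          (+-suc i r) (complete-prec p q d (suc r) K)
    ⨾ more (step-precFrame u b x i (suc r) K) (complete q e (precFrame b x (suc i) r K))

  complete-mu : ∀ {c f x k y} → Rep c f → Mu f x k y → ∀ K → ev c (pair x k) (muFrame c x k K) ↦ ret y K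
  complete-mu {c} {x = x} {k} p (found d) K =
    complete p d (muFrame c x k K) ⨾ more (step-muFrame 0 c x k K) stop
  complete-mu {c} {x = x} {k} p (next {m = m} d e) K =
    complete p d (muFrame c x k K) ⨾ more (step-muFrame (suc m) c x k K) (complete-mu p e K)

HaltsWithin : ℕ → ℕ → Set
HaltsWithin n s = ∃ λ m → m < n × Halted (run m s)

halts-step : ∀ {n s t} → step s ≡ t → ¬ Halted s → HaltsWithin (suc n) s → HaltsWithin n t
halts-step refl ¬h (zero  , _       , h) = contradiction h ¬h
halts-step refl ¬h (suc m , s≤s m<n , h) = m , m<n , h

mutual
  -- A halting run comes with no derivation to recurse on, so the bound `n` on its length takes that
  -- role. The conclusion keeps a bound `n` for the rest of the run, which lets the remaining
  -- premises be treated in turn.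
  sound : ∀ n {c D x} → Rep c D → ∀ K → HaltsWithin n (ev c x K) →
          ∃ λ v → Eval D x v × HaltsWithin n (ret v K)
  sound zero p K (_ , () , _)
  sound (suc n) {c} {x = x} (rep p) K h
    with v , d , m , m<n , e ← soundT n p K (halts-step (step-ev c x K) (running-ev c x K) h) =
    v , d , m , m<n⇒m<1+n m<n , e

  soundT : ∀ n {t r D x} → RepT t r D → ∀ K → HaltsWithin n (evStep t r x K) →
           ∃ λ v → Eval D x v × HaltsWithin n (ret v K)
  soundT n rzero K h = _ , ezero , h
  soundT n rjunk K h = _ , ezero , h
  soundT n rsucc K h = _ , esucc , h
  soundT n rid K h = _ , eid , h
  soundT n rleft K h = _ , eleft , h
  soundT n rright K h = _ , eright , h
  soundT zero (rcomp p q) K (_ , () , _)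
  soundT (suc n) {r = r} (rcomp p q) K h
    with y , d , h₁ ← sound (suc n) q (composeFrame (fst r) K) h
    with v , e , m , m<n , h₂ ← sound n p K (halts-step (step-frame y 1 (fst r) K) (running-frame y 0 (fst r) K) h₁) =
    v , ecomp d e , m , m<n⇒m<1+n m<n , h₂
  soundT zero (rpair p q) K (_ , () , _)
  soundT (suc n) {r = r} {x = x} (rpair p q) K h
    with y , d , h₁ ← sound (suc n) p (pairFrame (snd r) x K) h
    with z , e , h₂ ← sound n q (pairedFrame y K)
                        (halts-step (step-pairFrame y (snd r) x K) (running-pairFrame y (snd r) x K) h₁)
    with m , m<n , h₃ ← halts-step′ (step-frame z 3 y K) (running-frame z 2 y K) h₂ =
    pair y z , epair d e , m , m<n⇒m<1+n m<n , h₃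
  soundT n {r = r} {x = x} (rprec p q) K h
    with y , d , h₁ ← sound n p (precFrame (snd r) (fst x) 0 (snd x) K) h
    with v , e , h₂ ← sound-prec n q (snd x) (pz d) K h₁ = v , eprec e , h₂
  soundT n {r = r} {x = x} (rmu p) K h
    with v , d , h₁ ← sound-mu n p K h = v , emu d , h₁

  halts-step′ : ∀ {n s t} → step s ≡ t → ¬ Halted s → HaltsWithin n s → HaltsWithin n t
  halts-step′ {suc n} e ¬h h with m , m<n , h₁ ← halts-step e ¬h h = m , m<n⇒m<1+n m<n , h₁

  sound-prec : ∀ n {b f g x i w} → Rep b g → ∀ r → PRec f g x i w → ∀ K →
               HaltsWithin n (ret w (precFrame b x i r K)) →
               ∃ λ v → PRec f g x (i + r) v × HaltsWithin n (ret v K)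
  sound-prec n {b} {f} {g} {x} {i} {w} q zero d K h =
    w , subst (λ j → PRec f g x j w) (sym (+-identityʳ i)) d ,
    halts-step′ (step-precFrame w b x i 0 K) (running-precFrame w b x i _ K) h
  sound-prec zero q (suc r) d K (_ , () , _)
  sound-prec (suc n) {b} {f} {g} {x} {i} {w} q (suc r) d K h
    with y , e , h₁ ← sound n q (precFrame b x (suc i) r K)
                        (halts-step (step-precFrame w b x i (suc r) K) (running-precFrame w b x i _ K) h)
    with v , d′ , m , m<n , h₂ ← sound-prec n q r (ps d e) K h₁ =
    v , subst (λ j → PRec f g x j v) (sym (+-suc i r)) d′ , m , m<n⇒m<1+n m<n , h₂

  sound-mu : ∀ n {c f x k} → Rep c f → ∀ K → HaltsWithin n (ev c (pair x k) (muFrame c x k K)) →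
             ∃ λ y → Mu f x k y × HaltsWithin n (ret y K)
  sound-mu zero p K (_ , () , _)
  sound-mu (suc n) {c} {x = x} {k} p K h with sound (suc n) p (muFrame c x k K) h
  ... | zero  , d , h₁ = k , found d , halts-step′ (step-muFrame 0 c x k K) (running-muFrame 0 c x k K) h₁
  ... | suc v , d , h₁
    with y , e , m , m<n , h₂ ← sound-mu n p K (halts-step (step-muFrame (suc v) c x k K) (running-muFrame (suc v) c x k K) h₁) =
    y , next d e , m , m<n⇒m<1+n m<n , h₂

↦⇒run : ∀ {s t} → s ↦ t → ∃ λ n → run n s ≡ t
↦⇒run stop = 0 , refl
↦⇒run (more refl p) with n , eq ← ↦⇒run p = suc n , eq

opaque
  halts : ℕ → ℕ → ℕ → ℕ
  halts c x n = haltTest (run n (ev c x 0))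

  -- A halted state is a fixed point of `step`.
  halts-mono : ∀ c x {m n} → m ≤ n → halts c x m ≡ 0 → halts c x n ≡ 0
  halts-mono c x {m} {n} m≤n h = subst (λ k → halts c x k ≡ 0) (m+[n∸m]≡n m≤n)
    (trans (cong haltTest (trans (run-+ m (n ∸ m) (ev c x 0)) (run-halted (n ∸ m) h))) h)

  W⇔halts : ∀ c x → W c x ⇔ (∃ λ n → halts c x n ≡ 0)
  W⇔halts c x = to , from
    where
      to : W c x → ∃ λ n → halts c x n ≡ 0
      to (v , d) with n , eq ← ↦⇒run (complete (decode-rep c) d 0) =
        n , trans (cong haltTest eq) (halted-ret v)
      from : (∃ λ n → halts c x n ≡ 0) → W c x
      from (n , h) with v , d , _ ← sound (suc n) (decode-rep c) 0 (n , ≤-refl , h) = v , d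

switch′ : ∀ {n} → Exp n → List (Exp n) → Exp n → Exp n
switch′ t []       d = d
switch′ t (a ∷ as) d = ifz′ t a (switch′ (pred′ t) as d)

opaque
  unfolding ret ev frame pairFrame precFrame muFrame

  ret-comp : Comp 2 ret
  ret-comp = by (pair′ (lit 0) (pair′ #0 #1)) λ { (_ ∷ _ ∷ []) → refl }

  ev-comp : Comp 3 ev
  ev-comp = by (pair′ (lit 1) (pair′ #0 (pair′ #1 #2))) λ { (_ ∷ _ ∷ _ ∷ []) → refl }

  frame-comp : Comp 3 frame
  frame-comp = by (pair′ #0 (pair′ #1 #2)) λ { (_ ∷ _ ∷ _ ∷ []) → refl }

  pairFrame-comp : Comp 3 pairFrame
  pairFrame-comp = by (call frame-comp (lit 2 ∷ pair′ #0 #1 ∷ #2 ∷ [])) λ { (_ ∷ _ ∷ _ ∷ []) → refl }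

  precFrame-comp : Comp 5 precFrame
  precFrame-comp = by (call frame-comp (lit 4 ∷ pair′ (pair′ #0 #1) (pair′ #2 #3) ∷ #4 ∷ []))
    λ { (_ ∷ _ ∷ _ ∷ _ ∷ _ ∷ []) → refl }

  muFrame-comp : Comp 4 muFrame
  muFrame-comp = by (call frame-comp (lit 5 ∷ pair′ (pair′ #0 #1) #2 ∷ #3 ∷ []))
    λ { (_ ∷ _ ∷ _ ∷ _ ∷ []) → refl }

ret′ : ∀ {n} → Exp n → Exp n → Exp n
ret′ v K = call ret-comp (v ∷ K ∷ [])

ev′ : ∀ {n} → Exp n → Exp n → Exp n → Exp n
ev′ c x K = call ev-comp (c ∷ x ∷ K ∷ [])

frame′ : ∀ {n} → Exp n → Exp n → Exp n → Exp n
frame′ t d K = call frame-comp (t ∷ d ∷ K ∷ [])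

pairFrame′ : ∀ {n} → Exp n → Exp n → Exp n → Exp n
pairFrame′ g x K = call pairFrame-comp (g ∷ x ∷ K ∷ [])

precFrame′ : ∀ {n} → Exp n → Exp n → Exp n → Exp n → Exp n → Exp n
precFrame′ g x i r K = call precFrame-comp (g ∷ x ∷ i ∷ r ∷ K ∷ [])

muFrame′ : ∀ {n} → Exp n → Exp n → Exp n → Exp n → Exp n
muFrame′ f x k K = call muFrame-comp (f ∷ x ∷ k ∷ K ∷ [])

precStep-comp : Comp 6 precStep
precStep-comp = by
  (let v = #0; g = #1; x = #2; i = #3; r = #4; K = #5 in
   ifz′ r (ret′ v K) (ev′ g (pair′ (pair′ x i) v) (precFrame′ g x (suc′ i) (pred′ r) K)))
  λ { (_ ∷ _ ∷ _ ∷ _ ∷ _ ∷ _ ∷ []) → refl }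

muStep-comp : Comp 5 muStep
muStep-comp = by
  (let v = #0; f = #1; x = #2; k = #3; K = #4 in
   ifz′ v (ret′ k K) (ev′ f (pair′ x (suc′ k)) (muFrame′ f x (suc′ k) K)))
  λ { (_ ∷ _ ∷ _ ∷ _ ∷ _ ∷ []) → refl }

evStep-comp : Comp 4 evStep
evStep-comp = by
  (let t = #0; r = #1; x = #2; K = #3 in switch′ t
    ( ret′ (lit 0) K
    ∷ ret′ (suc′ x) K
    ∷ ret′ x K
    ∷ ret′ (fst′ x) K
    ∷ ret′ (snd′ x) K
    ∷ ev′ (snd′ r) x (frame′ (lit 1) (fst′ r) K)
    ∷ ev′ (fst′ r) x (pairFrame′ (snd′ r) x K)
    ∷ ev′ (fst′ r) (fst′ x) (precFrame′ (snd′ r) (fst′ x) (lit 0) (snd′ x) K)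
    ∷ ev′ r (pair′ x (lit 0)) (muFrame′ r x (lit 0) K)
    ∷ []) (ret′ (lit 0) K))
  λ { (_ ∷ _ ∷ _ ∷ _ ∷ []) → refl }

retStep-comp : Comp 5 retStep
retStep-comp = by
  (let s = #0; v = #1; t = #2; d = #3; K = #4 in switch′ t
    ( s
    ∷ ev′ d v K
    ∷ ev′ (fst′ d) (snd′ d) (frame′ (lit 3) v K)
    ∷ ret′ (pair′ d v) K
    ∷ call precStep-comp (v ∷ fst′ (fst′ d) ∷ snd′ (fst′ d) ∷ fst′ (snd′ d) ∷ snd′ (snd′ d) ∷ K ∷ [])
    ∷ []) (call muStep-comp (v ∷ fst′ (fst′ d) ∷ snd′ (fst′ d) ∷ snd′ d ∷ K ∷ [])))
  λ { (_ ∷ _ ∷ _ ∷ _ ∷ _ ∷ []) → refl }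

step-comp : Comp 1 step
step-comp = by
  (let s = #0; u = fst′ (snd′ s); w = snd′ (snd′ s) in ifz′ (fst′ s)
    (call retStep-comp (s ∷ u ∷ fst′ w ∷ fst′ (snd′ w) ∷ snd′ (snd′ w) ∷ []))
    (call evStep-comp (fst′ u ∷ snd′ u ∷ fst′ w ∷ snd′ w ∷ [])))
  λ { (_ ∷ []) → refl }

run-comp : Comp 2 run
run-comp = by (rec′ #1 (call step-comp (#0 ∷ [])) #0) λ { (n ∷ s ∷ []) → lemma n s }
  where
    lemma : ∀ n s → natrec s (λ _ → step) n ≡ run n s
    lemma zero    s = refl
    lemma (suc n) s = trans (cong step (lemma n s)) (sym (run-suc n s))

opaque
  unfolding halts

  halts-comp : Comp 3 halts
  halts-comp = by
    (let s = call run-comp (#2 ∷ ev′ #0 #1 (lit 0) ∷ []) in fst′ s +′ fst′ (snd′ (snd′ s)))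
    λ { (_ ∷ _ ∷ _ ∷ []) → refl }

-- A normal form for Σ₅ sets

Σ₅ : Fun 6 → Pred
Σ₅ R x = ∃ λ a → ∀ b → ∃ λ c → ∀ d → ∃ λ s → R x a b c d s ≡ 0

-- The nesting is the one that unfolding `Sigma 5` produces, where every quantifier adds its
-- variable on the right.
tuple : Fun 6
tuple x a b c d s = pair (pair (pair (pair (pair x a) b) c) d) s

untuple : Fun 6 → ℕ → ℕ
untuple R z = R (fst (fst (fst (fst (fst z))))) (snd (fst (fst (fst (fst z)))))
                (snd (fst (fst (fst z)))) (snd (fst (fst z))) (snd (fst z)) (snd z)

untuple-tuple : ∀ R x a b c d s → untuple R (tuple x a b c d s) ≡ R x a b c d s
untuple-tuple R x a b c d s = trans
  (cong₃ (λ x a b → R x a b (snd (fst (fst z))) (snd (fst z)) (snd z))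
    (trans (cong fst e₁) (fst-pair x a))
    (trans (cong snd e₁) (snd-pair x a))
    (trans (cong snd e₂) (snd-pair z₁ b)))
  (cong₃ (R x a b)
    (trans (cong snd e₃) (snd-pair z₂ c))
    (trans (cong snd e₄) (snd-pair z₃ d))
    (snd-pair z₄ s))
  where
    z₁ z₂ z₃ z₄ z : ℕ
    z₁ = pair x a
    z₂ = pair z₁ b
    z₃ = pair z₂ c
    z₄ = pair z₃ d
    z  = pair z₄ s
    e₄ : fst z ≡ z₄
    e₄ = fst-pair z₄ s
    e₃ : fst (fst z) ≡ z₃
    e₃ = trans (cong fst e₄) (fst-pair z₃ d)
    e₂ : fst (fst (fst z)) ≡ z₂
    e₂ = trans (cong fst e₃) (fst-pair z₂ c)
    e₁ : fst (fst (fst (fst z))) ≡ z₁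
    e₁ = trans (cong fst e₂) (fst-pair z₁ b)

⇔-refl : ∀ {P} → P ⇔ P
⇔-refl = (λ p → p) , (λ p → p)

⇔-trans : ∀ {P Q R} → P ⇔ Q → Q ⇔ R → P ⇔ R
⇔-trans (f , f′) (g , g′) = (λ p → g (f p)) , (λ r → f′ (g′ r))

⇔-sym : ∀ {P Q} → P ⇔ Q → Q ⇔ P
⇔-sym (f , f′) = f′ , f

∃-cong : ∀ {P Q : Pred} → (∀ n → P n ⇔ Q n) → (∃ P) ⇔ (∃ Q)
∃-cong e = (λ { (n , p) → n , proj₁ (e n) p }) , (λ { (n , q) → n , proj₂ (e n) q })

∀-cong : ∀ {P Q : Pred} → (∀ n → P n ⇔ Q n) → (∀ n → P n) ⇔ (∀ n → Q n)
∀-cong e = (λ p n → proj₁ (e n) (p n)) , (λ q n → proj₂ (e n) (q n))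

≡⇒⇔ : ∀ {P Q : Set} → P ≡ Q → P ⇔ Q
≡⇒⇔ refl = ⇔-refl

Σ₅-cong : ∀ {R S : Fun 6} → (∀ x a b c d s → R x a b c d s ≡ S x a b c d s) → ∀ x → Σ₅ R x ⇔ Σ₅ S x
Σ₅-cong e x =
  ∃-cong λ a → ∀-cong λ b → ∃-cong λ c → ∀-cong λ d → ∃-cong λ s → ≡⇒⇔ (cong (_≡ 0) (e x a b c d s))

Σ₅⇒Sigma : ∀ {A} R → Comp 6 R → (∀ x → A x ⇔ Σ₅ R x) → Sigma 5 A
Σ₅⇒Sigma {A} R R-comp A⇔ =
  _ , (_ , (_ , (_ , (_ , lift (χ , Comp⇒Computable χ-comp , λ _ → ⇔-refl)
    , λ _ → ⇔-refl) , λ _ → ⇔-refl) , λ _ → ⇔-refl) , λ _ → ⇔-refl)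
  , λ x → ⇔-trans (A⇔ x) (Σ₅-cong (λ x a b c d s → sym (untuple-tuple R x a b c d s)) x)
  where
    χ : ℕ → ℕ
    χ = untuple R
    χ-comp : Comp 1 χ
    χ-comp = by
      (let z₄ = fst′ #0; z₃ = fst′ z₄; z₂ = fst′ z₃; z₁ = fst′ z₂ in
       call R-comp (fst′ z₁ ∷ snd′ z₁ ∷ snd′ z₂ ∷ snd′ z₃ ∷ snd′ z₄ ∷ snd′ #0 ∷ []))
      λ { (_ ∷ []) → refl }

Sigma⇒Σ₅ : ∀ {A} → Sigma 5 A → ∃ λ R → Comp 6 R × (∀ x → A x ⇔ Σ₅ R x)
Sigma⇒Σ₅ (A₁ , (A₂ , (A₃ , (A₄ , (A₅ , lift (χ , χ-computable , e₅) , e₄) , e₃) , e₂) , e₁) , e₀) =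
  (λ x a b c d s → χ (tuple x a b c d s)) ,
  by (call (Computable⇒Comp χ-computable)
       (pair′ (pair′ (pair′ (pair′ (pair′ #0 #1) #2) #3) #4) #5 ∷ []))
     (λ { (_ ∷ _ ∷ _ ∷ _ ∷ _ ∷ _ ∷ []) → refl }) ,
  λ x → ⇔-trans (e₀ x) (∃-cong λ a → ⇔-trans (e₁ _) (∀-cong λ b → ⇔-trans (e₂ _)
    (∃-cong λ c → ⇔-trans (e₃ _) (∀-cong λ d → ⇔-trans (e₄ _) (∃-cong λ s → e₅ _)))))

-- Upper bound; recursive tests return 0 for true

imp : ℕ → ℕ → ℕ
imp m n = ifz m n 0

imp-intro : ∀ {m n} → (m ≡ 0 → n ≡ 0) → imp m n ≡ 0
imp-intro {zero}  f = f refl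
imp-intro {suc m} f = refl

imp-elim : ∀ {m n} → imp m n ≡ 0 → m ≡ 0 → n ≡ 0
imp-elim p refl = p

imp′ : ∀ {n} → Exp n → Exp n → Exp n
imp′ d e = ifz′ d e (lit 0)

sumTo : (ℕ → ℕ) → ℕ → ℕ
sumTo f = natrec 0 (λ i w → f i + w)

sumTo-intro : ∀ {f} n → (∀ i → i < n → f i ≡ 0) → sumTo f n ≡ 0
sumTo-intro zero    p = refl
sumTo-intro (suc n) p = cong₂ _+_ (p n ≤-refl) (sumTo-intro n (λ i i<n → p i (m<n⇒m<1+n i<n)))

sumTo-elim : ∀ {f} n → sumTo f n ≡ 0 → ∀ i → i < n → f i ≡ 0
sumTo-elim {f} (suc n) eq i i<1+n with m<1+n⇒m<n∨m≡n i<1+n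
... | inj₁ i<n  = sumTo-elim n (m+n≡0⇒n≡0 (f n) eq) i i<n
... | inj₂ refl = m+n≡0⇒m≡0 (f n) eq

-- Collection: by monotonicity the maximum of finitely many witnesses serves for all of them.
bounded-choice : ∀ {P : ℕ → ℕ → Set} → (∀ {i r s} → r ≤ s → P i r → P i s) →
                 ∀ n → (∀ i → i < n → ∃ (P i)) → ∃ λ r → ∀ i → i < n → P i r
bounded-choice mono zero    p = 0 , λ _ ()
bounded-choice {P} mono (suc n) p
  with r , q ← bounded-choice mono n (λ i i<n → p i (m<n⇒m<1+n i<n))
  with s , q′ ← p n ≤-refl = r ⊔ s , uniform
  where
    uniform : ∀ i → i < suc n → P i (r ⊔ s)
    uniform i i<1+n with m<1+n⇒m<n∨m≡n i<1+n
    ... | inj₁ i<n  = mono (m≤m⊔n r s) (q i i<n)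
    ... | inj₂ refl = mono (m≤n⊔m r s) q′

member≤sum : ∀ {k} {F : List ℕ} → k ∈ F → k ≤ sum F
member≤sum {F = k ∷ F} (here refl) = m≤m+n k (sum F)
member≤sum {F = l ∷ F} (there k∈F) = ≤-trans (member≤sum k∈F) (m≤n+m (sum F) l)

≐-sym : ∀ {A B} → A ≐ B → B ≐ A
≐-sym e x = proj₂ (e x) , proj₁ (e x)

≐-trans : ∀ {A B C} → A ≐ B → B ≐ C → A ≐ C
≐-trans e e′ x = (λ p → proj₁ (e′ x) (proj₁ (e x) p)) , (λ p → proj₂ (e x) (proj₂ (e′ x) p))

hits : ℕ → ℕ → ℕ → ℕ → ℕ
hits e j y r = halts e (pair j y) r

hits′ : ∀ {n} → Exp n → Exp n → Exp n → Exp n → Exp n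
hits′ e j y r = call halts-comp (e ∷ pair′ j y ∷ r ∷ [])

-- The matrix of the Π₂ form of equality: for all `y` and `r`, what one language has enumerated by
-- stage `r` the other enumerates by some stage `s`.
same : ℕ → ℕ → ℕ → ℕ → ℕ → ℕ → ℕ
same e j k y r s = imp (hits e j y r) (hits e k y s) + imp (hits e k y r) (hits e j y s)

same-comp : Comp 6 same
same-comp = by
  (let e = #0; j = #1; k = #2; y = #3; r = #4; s = #5 in
   imp′ (hits′ e j y r) (hits′ e k y s) +′ imp′ (hits′ e k y r) (hits′ e j y s))
  λ { (_ ∷ _ ∷ _ ∷ _ ∷ _ ∷ _ ∷ []) → refl }

stageSub : ℕ → ℕ → ℕ → ℕ → ℕ → ℕ
stageSub e j k t r = sumTo (λ x → imp (hits e j x t) (hits e k x r)) t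

stageSub-comp : Comp 5 stageSub
stageSub-comp = by
  (rec′ (lit 0)
    (let w = #0; x = #1; e = #2; j = #3; k = #4; t = #5; r = #6 in
     imp′ (hits′ e j x t) (hits′ e k x r) +′ w)
    #3)
  λ { (_ ∷ _ ∷ _ ∷ _ ∷ _ ∷ []) → refl }

-- A number w < N names a member equal to L^e_j; a number w = N + t says that the part of
-- L^e_j below t enumerated by stage t is a positive teaching set.
goodTest : Fun 6
goodTest e N j w m s = ifz (suc w ∸ N)
  (same e j w (fst m) (snd m) s)
  (imp (stageSub e j (fst m) (w ∸ N) (fst (snd m))) (same e j (fst m) (fst (snd (snd m))) (snd (snd (snd m))) s))

goodTest-comp : Comp 6 goodTest
goodTest-comp = by
  (let e = #0; N = #1; j = #2; w = #3; m = #4; s = #5 in ifz′ (suc′ w ∸′ N)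
    (call same-comp (e ∷ j ∷ w ∷ fst′ m ∷ snd′ m ∷ s ∷ []))
    (imp′ (call stageSub-comp (e ∷ j ∷ fst′ m ∷ (w ∸′ N) ∷ fst′ (snd′ m) ∷ []))
          (call same-comp (e ∷ j ∷ fst′ m ∷ fst′ (snd′ (snd′ m)) ∷ snd′ (snd′ (snd′ m)) ∷ s ∷ []))))
  λ { (_ ∷ _ ∷ _ ∷ _ ∷ _ ∷ _ ∷ []) → refl }

L⇔hits : ∀ e j y → L e j y ⇔ (∃ λ r → hits e j y r ≡ 0)
L⇔hits e j y = W⇔halts e (pair j y)

hits-mono : ∀ e j y {r s} → r ≤ s → hits e j y r ≡ 0 → hits e j y s ≡ 0
hits-mono e j y = halts-mono e (pair j y)

same⇒≐ : ∀ e j k → (∀ y r → ∃ λ s → same e j k y r s ≡ 0) → L e j ≐ L e k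
same⇒≐ e j k p y = to , from
  where
    to : L e j y → L e k y
    to l with r , h ← proj₁ (L⇔hits e j y) l with s , q ← p y r =
      proj₂ (L⇔hits e k y) (s , imp-elim (m+n≡0⇒m≡0 _ q) h)
    from : L e k y → L e j y
    from l with r , h ← proj₁ (L⇔hits e k y) l with s , q ← p y r =
      proj₂ (L⇔hits e j y) (s , imp-elim (m+n≡0⇒n≡0 (imp (hits e j y r) (hits e k y s)) q) h)

-- Since `hits` is decidable, the stage can be chosen before the premise is known; if the premise
-- fails, 0 will do.
follow : ∀ e y r j k → (L e j y → L e k y) → ∃ λ s → hits e j y r ≡ 0 → hits e k y s ≡ 0
follow e y r j k f with hits e j y r ≟ 0
... | no ¬h = 0 , λ h → contradiction h ¬h
... | yes h with s , h′ ← proj₁ (L⇔hits e k y) (f (proj₂ (L⇔hits e j y) (r , h))) = s , λ _ → h′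

≐⇒same : ∀ e j k → L e j ≐ L e k → ∀ y r → ∃ λ s → same e j k y r s ≡ 0
≐⇒same e j k eq y r
  with s , p ← follow e y r j k (proj₁ (eq y)) with s′ , p′ ← follow e y r k j (proj₂ (eq y)) = s ⊔ s′ , cong₂ _+_
    (imp-intro λ h → hits-mono e k y (m≤m⊔n s s′) (p h))
    (imp-intro λ h → hits-mono e j y (m≤n⊔m s s′) (p′ h))

module Classical (em : ExcludedMiddle 0ℓ) where

  double-negation : ∀ {P : Set} → ¬ ¬ P → P
  double-negation {P} ¬¬p with em {P}
  ... | yes p = p
  ... | no ¬p = contradiction ¬p ¬¬p

  ¬∀⇒∃¬ : ∀ {P : Pred} → ¬ (∀ n → P n) → ∃ λ n → ¬ P n
  ¬∀⇒∃¬ ¬p = double-negation λ ¬q → ¬p λ n → double-negation λ ¬pn → ¬q (n , ¬pn)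

  least : ∀ {P : Pred} n → P n → ∃ λ m → P m × (∀ k → k < m → ¬ P k)
  least {P} zero p = 0 , p , λ _ ()
  least {P} (suc n) p with em {P 0}
  ... | yes p₀ = 0 , p₀ , λ _ ()
  ... | no ¬p₀ with m , pm , below ← least {λ k → P (suc k)} n p =
    suc m , pm , λ { zero _ → ¬p₀ ; (suc k) (s≤s k<m) → below k k<m }

module Upper (em : ExcludedMiddle 0ℓ) where

  open Classical em

  -- That the stage-`t` part lies in L^e_k is witnessed by a stage `r`; as a hypothesis this turns
  -- into a universal quantifier. With equality being Π₂, `Taught` is Π₂, hence `∃ t` makes it Σ₃
  -- and the quantifiers over `j` and `N` give Σ₅.
  Taught : ℕ → ℕ → ℕ → Set
  Taught e j t = ∀ k r → stageSub e j k t r ≡ 0 → L e j ≐ L e k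

  -- Enlarging a teaching set within its language keeps it one, so any `t` whose part contains `S`
  -- will do.
  TD⇒Taught : ∀ e j → TD⁺Finite e j → ∃ (Taught e j)
  TD⇒Taught e j (S , S⊆L , teaches) = let t , p = stage S S⊆L in t , λ k r sub →
    double-negation λ L≢ → teaches (k , (λ eq → L≢ (≐-sym eq)) ,
      All.map (λ { {x} (x<t , h) → proj₂ (L⇔hits e k x) (r , imp-elim (sumTo-elim t sub x x<t) h) }) p)
    where
      Stage : ℕ → ℕ → Set
      Stage t x = x < t × hits e j x t ≡ 0
      Stage-mono : ∀ {t u x} → t ≤ u → Stage t x → Stage u x
      Stage-mono {x = x} t≤u (x<t , h) = ≤-trans x<t t≤u , hits-mono e j x t≤u h
      stage : ∀ S → S ⊆ₗ L e j → ∃ λ t → All (Stage t) S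
      stage [] [] = 0 , []
      stage (x ∷ S) (l ∷ ls) with r , h ← proj₁ (L⇔hits e j x) l with t , p ← stage S ls =
        u , ((≤-trans (m≤m⊔n (suc x) r) (m≤m⊔n (suc x ⊔ r) t) ,
              hits-mono e j x (≤-trans (m≤n⊔m (suc x) r) (m≤m⊔n (suc x ⊔ r) t)) h)
             ∷ All.map (Stage-mono (m≤n⊔m (suc x ⊔ r) t)) p)
        where
          u : ℕ
          u = suc x ⊔ r ⊔ t

  Taught⇒TD : ∀ e j t → Taught e j t → TD⁺Finite e j
  Taught⇒TD e j t taught = S , All.tabulate S⊆L , λ { (k , L≢ , S⊆) → L≢ (≐-sym (covers⇒≐ k S⊆)) }
    where
      S : List ℕ
      S = filter (λ x → hits e j x t ≟ 0) (upTo t)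
      S⊆L : ∀ {x} → x ∈ S → L e j x
      S⊆L {x} x∈S = proj₂ (L⇔hits e j x) (t , proj₂ (∈-filter⁻ (λ x → hits e j x t ≟ 0) {xs = upTo t} x∈S))
      covers⇒≐ : ∀ k → S ⊆ₗ L e k → L e j ≐ L e k
      covers⇒≐ k S⊆ = taught k (proj₁ uniform) (sumTo-intro t (proj₂ uniform))
        where
          eventually : ∀ x → x < t → ∃ λ r → imp (hits e j x t) (hits e k x r) ≡ 0
          eventually x x<t with hits e j x t ≟ 0
          ... | no ¬h = 0 , imp-intro λ h → contradiction h ¬h
          ... | yes h with r , h′ ← proj₁ (L⇔hits e k x)
                  (All.lookup S⊆ (∈-filter⁺ (λ x → hits e j x t ≟ 0) (∈-upTo⁺ x<t) h)) =
            r , imp-intro λ _ → h′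
          uniform : ∃ λ r → ∀ x → x < t → imp (hits e j x t) (hits e k x r) ≡ 0
          uniform = bounded-choice
            (λ {x} r≤s p → imp-intro λ h → hits-mono e k x r≤s (imp-elim p h)) t eventually

  I⇒Σ₅ : ∀ e → I-TD⁺ e → Σ₅ goodTest e
  I⇒Σ₅ e (F , p) = N , λ j → witness j
    where
      N : ℕ
      -- The successor puts every index in `F` strictly below `N`.
      N = suc (sum F)
      witness : ∀ j → ∃ λ w → ∀ m → ∃ λ s → goodTest e N j w m s ≡ 0
      witness j with em {TD⁺Finite e j}
      ... | no ¬td with k , k∈F , eq ← find (p j ¬td) = k , λ m → accept m (≐⇒same e j k eq (fst m) (snd m))
        where
          accept : ∀ m → (∃ λ s → same e j k (fst m) (snd m) s ≡ 0) → ∃ λ s → goodTest e N j k m s ≡ 0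
          accept m rewrite m≤n⇒m∸n≡0 (member≤sum k∈F) = λ q → q
      ... | yes td with t , taught ← TD⇒Taught e j td = N + t , accept
        where
          accept : ∀ m → ∃ λ s → goodTest e N j (N + t) m s ≡ 0
          accept m rewrite +-∸-assoc 1 (m≤m+n N t) | m+n∸m≡n N t
            with stageSub e j (fst m) t (fst (snd m)) in eq
          ... | suc _ = 0 , refl
          ... | zero  = ≐⇒same e j (fst m) (taught (fst m) (fst (snd m)) eq) (fst (snd (snd m))) (snd (snd (snd m)))

  Σ₅⇒I : ∀ e → Σ₅ goodTest e → I-TD⁺ e
  Σ₅⇒I e (N , p) = upTo N , λ j ¬td → member j ¬td (p j)
    where
      member : ∀ j → ¬ TD⁺Finite e j → (∃ λ w → ∀ m → ∃ λ s → goodTest e N j w m s ≡ 0) →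
               Any (λ k → L e j ≐ L e k) (upTo N)
      member j ¬td (w , q) with suc w ∸ N in eq
      ... | zero = lose (∈-upTo⁺ {N} (m∸n≡0⇒m≤n eq)) (same⇒≐ e j w λ y r →
        let s , h = q (pair y r) in
        s , trans (cong₂ (λ y r → same e j w y r s) (sym (fst-pair y r)) (sym (snd-pair y r))) h)
      ... | suc _ = contradiction (Taught⇒TD e j (w ∸ N) taught) ¬td
        where
          taught : Taught e j (w ∸ N)
          taught k r sub = same⇒≐ e j k λ y r′ →
            -- In its second case `goodTest` reads its universal variables from a code of this
            -- shape.
            let n = pair y r′
                m = pair k (pair r n)
                s , h = q m
                k≡ = fst-pair k (pair r n)
                tail≡ = snd-pair k (pair r n)
                r≡ = trans (cong fst tail≡) (fst-pair r n)
                n≡ = trans (cong snd tail≡) (snd-pair r n)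
            in s , imp-elim
              (trans (sym (trans
                (cong₃ (λ k r n → imp (stageSub e j k (w ∸ N) r) (same e j k (fst n) (snd n) s)) k≡ r≡ n≡)
                (cong₂ (λ y r′ → imp (stageSub e j k (w ∸ N) r) (same e j k y r′ s))
                  (fst-pair y r′) (snd-pair y r′)))) h)
              sub

  I-Sigma : Sigma 5 I-TD⁺
  I-Sigma = Σ₅⇒Sigma goodTest goodTest-comp λ e → I⇒Σ₅ e , Σ₅⇒I e

-- Hardness

-- A code of `constC k` that is visibly recursive in `k`; `encode` is abstract and not known to be
-- recursive.
constCode : ℕ → ℕ
constCode = natrec (proj₁ (encode zeroC)) (λ _ w → pair 5 (pair (proj₁ (encode succC)) w))

constCode-rep : ∀ k → Rep (constCode k) (constC k)
constCode-rep zero    = proj₂ (encode zeroC)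
constCode-rep (suc k) = rep-comp (proj₂ (encode succC)) (constCode-rep k)

module Section (c : Code) where

  opaque
    section : ℕ → ℕ
    section x = pair 5 (pair (proj₁ (encode c)) (pair 6 (pair (constCode x) (proj₁ (encode idC)))))

    section-decode : ∀ x → decode (section x) ≡ compC c (pairC (constC x) idC)
    section-decode x =
      rep⇒decode (rep-comp (proj₂ (encode c)) (rep-pair (constCode-rep x) (proj₂ (encode idC))))

    section-comp : Comp 1 section
    section-comp = by
      (pair′ (lit 5) (pair′ (lit (proj₁ (encode c))) (pair′ (lit 6) (pair′
        (rec′ (lit (proj₁ (encode zeroC))) (pair′ (lit 5) (pair′ (lit (proj₁ (encode succC))) #0)) #0)
        (lit (proj₁ (encode idC)))))))
      λ { (_ ∷ []) → refl }

-- `n + k` is a known zero, but the search stops at the first one, so only the existence of a result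
-- is claimed.
mu-search : ∀ {c x} (f : ℕ → ℕ) → (∀ k → Eval c (pair x k) (f k)) →
            ∀ n k → f (n + k) ≡ 0 → ∃ (Mu c x k)
mu-search {c} {x} f ev n k eq with f k in fk
mu-search {c} {x} f ev n k eq | zero = k , found (subst (Eval c (pair x k)) fk (ev k))
mu-search {c} {x} f ev zero k eq | suc _ = contradiction (trans (sym fk) eq) λ ()
mu-search {c} {x} f ev (suc n) k eq | suc _
  with y , p ← mu-search f ev n (suc k) (trans (cong f (+-suc n k)) eq) =
  y , next (subst (Eval c (pair x k)) fk (ev k)) p

mu-sound : ∀ {c x k y} (f : ℕ → ℕ) → (∀ k → Eval c (pair x k) (f k)) → Mu c x k y → ∃ λ n → f n ≡ 0
mu-sound f ev (found {k} p) = k , Eval-functional (ev k) p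
mu-sound f ev (next _ p) = mu-sound f ev p

-- The program searches for `p`, and `section` hard-wires `x` into it.
smn : ∀ g → Comp 3 g → ∃ λ f → Computable f × (∀ x z → W (f x) z ⇔ (∃ λ p → g x z p ≡ 0))
smn g g-comp = section , Comp⇒Computable section-comp , λ x z → to x z , from x z
  where
    test : ∃ λ c → ∀ v → Eval c v (g (fst (fst v)) (snd (fst v)) (snd v))
    test with c , p ← by {1} {λ v → g (fst (fst v)) (snd (fst v)) (snd v)}
                          (call g-comp (fst′ (fst′ #0) ∷ snd′ (fst′ #0) ∷ snd′ #0 ∷ [])) (λ { (_ ∷ []) → refl }) =
      compC c (pairC zeroC idC) , λ v → ecomp (epair ezero eid) (p (v ∷ []))
    c : Code
    c = proj₁ test
    open Section (muC c)
    test-eval : ∀ x z k → Eval c (pair (pair x z) k) (g x z k)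
    test-eval x z k = subst (Eval c v)
      (cong₃ g (trans (cong fst e) (fst-pair x z)) (trans (cong snd e) (snd-pair x z)) (snd-pair (pair x z) k))
      (proj₂ test v)
      where
        v : ℕ
        v = pair (pair x z) k
        e : fst v ≡ pair x z
        e = fst-pair (pair x z) k
    to : ∀ x z → W (section x) z → ∃ λ p → g x z p ≡ 0
    to x z (v , d) with subst (λ d → Eval d z v) (section-decode x) d
    ... | ecomp (epair d₁ eid) (emu m) with refl ← Eval-functional d₁ (const-eval x) =
      mu-sound (g x z) (test-eval x z) m
    from : ∀ x z → (∃ λ p → g x z p ≡ 0) → W (section x) z
    from x z (p , eq)
      with v , m ← mu-search (g x z) (test-eval x z) p 0 (trans (cong (g x z) (+-identityʳ p)) eq) =
      v , subst (λ d → Eval d z v) (sym (section-decode x)) (ecomp (epair (const-eval x) eid) (emu m))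

-- Unbounded search and its records

tri-mono : ∀ {m n} → m ≤ n → tri m ≤ tri n
tri-mono z≤n = z≤n
tri-mono (s≤s m≤n) = s≤s (+-mono-≤ m≤n (tri-mono m≤n))

pair-monoʳ : ∀ x {y z} → y ≤ z → pair x y ≤ pair x z
pair-monoʳ x y≤z = +-mono-≤ (tri-mono (+-monoʳ-≤ x y≤z)) y≤z

-- A search for an a with ∀ b. ∃ c. P a b c starts at a = b = 0 and moves from (a , b) to
-- (a , b + 1) if some c satisfies P a b, and to (a + 1 , 0) otherwise.  It is recorded by
-- the numbers Mark a b m, and its finite records ending before an increase of a form a
-- bounded set precisely when a stops increasing.
module Search (em : ExcludedMiddle 0ℓ) (P : ℕ → ℕ → ℕ → Set) where

  open Classical em

  -- Leastness of the witness leaves at most one true mark at each pair (a, b). For a Π₂ predicate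
  -- `P` every mark is a Π₃ statement.
  Mark : ℕ → ℕ → ℕ → Set
  Mark a b zero    = ∀ c → ¬ P a b c
  Mark a b (suc c) = P a b c × (∀ c′ → c′ < c → ¬ P a b c′)

  -- A record is a list of marks, with 0 for the empty list and suc (pair m r) for m ∷ r.
  data Record (a b : ℕ) : ℕ → Set where
    end  : Mark a b 0 → Record a b 0
    skip : ∀ {r} → fst r ≡ 0 → Mark a b 0 → Record (suc a) 0 (snd r) → Record a b (suc r)
    move : ∀ {r c} → fst r ≡ suc c → Mark a b (suc c) → Record a (suc b) (snd r) → Record a b (suc r)

  Bounded : ℕ → ℕ → Set
  Bounded a b = ∃ λ N → ∀ r → Record a b r → r ≤ N

  -- A record must either end at the present `a` or leave it, and both require a refutation of `a`
  -- at some `b` still ahead.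
  no-record : ∀ {a b r} → (∀ d → ¬ Mark a (d + b) 0) → ¬ Record a b r
  no-record ¬m (end m) = ¬m 0 m
  no-record ¬m (skip _ m _) = ¬m 0 m
  no-record {a} {b} ¬m (move _ _ p) =
    no-record (λ d m → ¬m (suc d) (subst (λ b → Mark a b 0) (+-suc d b) m)) p

  record≤ : ∀ {m r N} → fst r ≡ m → snd r ≤ N → r ≤ pair m N
  record≤ {m} {r} {N} refl le = subst (_≤ pair m N) (pair-fst-snd r) (pair-monoʳ m le)

  Bounded-skip : ∀ {a b} → Mark a b 0 → Bounded (suc a) 0 → Bounded a b
  Bounded-skip {a} {b} m (N , bound) = suc (pair 0 N) , go
    where
      go : ∀ r → Record a b r → r ≤ suc (pair 0 N)
      go _ (end _) = z≤n
      go _ (skip {r} eq _ p) = s≤s (record≤ {0} {r} eq (bound _ p))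
      go _ (move {c = c} _ (pc , _) _) = contradiction pc (m c)

  -- Only the least witness can be the first mark, so a record is determined by its tail.
  Bounded-move : ∀ {a b} → ¬ Mark a b 0 → Bounded a (suc b) → Bounded a b
  Bounded-move {a} {b} ¬m (N , bound) with em {∃ λ c → Mark a b (suc c)}
  ... | no ¬mark = 0 , λ
    { _ (end m) → contradiction m ¬m
    ; _ (skip _ m _) → contradiction m ¬m
    ; _ (move _ m _) → contradiction (_ , m) ¬mark }
  ... | yes (c , pc , below) = suc (pair (suc c) N) , go
    where
      go : ∀ r → Record a b r → r ≤ suc (pair (suc c) N)
      go _ (end m) = contradiction m ¬m
      go _ (skip _ m _) = contradiction m ¬m
      go _ (move {r} {c′} eq (pc′ , below′) p) = s≤s (record≤ {suc c} {r} (trans eq (cong suc c′≡c)) (bound _ p))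
        where
          c′≡c : c′ ≡ c
          c′≡c = ≤-antisym (≮⇒≥ λ c<c′ → below′ c c<c′ pc) (≮⇒≥ λ c′<c → below c′ c′<c pc′)

  -- Either no refutation of `a` lies ahead, and there are no records, or the bound is carried back
  -- along the finitely many pairs before that refutation.
  Bounded-pred : ∀ {a} → Bounded (suc a) 0 → ∀ b → Bounded a b
  Bounded-pred {a} bnd b with em {∃ λ d → Mark a (d + b) 0}
  ... | no ¬m = 0 , λ r p → contradiction p (no-record λ d m → ¬m (d , m))
  ... | yes (d , m) = go d b m
    where
      go : ∀ d b → Mark a (d + b) 0 → Bounded a b
      go zero b m = Bounded-skip m bnd
      go (suc d) b m with em {Mark a b 0}
      ... | yes m₀ = Bounded-skip m₀ bnd
      ... | no ¬m₀ = Bounded-move ¬m₀ (go d (suc b) (subst (λ b → Mark a b 0) (sym (+-suc d b)) m))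

  -- Downward induction from an `a` that is never refuted, where no records exist.
  stops⇒Bounded : ∀ {a} → (∀ b → ¬ Mark a b 0) → ∀ k a₀ → k + a₀ ≡ a → ∀ b → Bounded a₀ b
  stops⇒Bounded ¬m zero    a₀ refl b = 0 , λ r p → contradiction p (no-record λ d → ¬m (d + b))
  stops⇒Bounded ¬m (suc k) a₀ eq b =
    Bounded-pred (stops⇒Bounded ¬m k (suc a₀) (trans (+-suc k a₀) eq) 0) b

  Large : ℕ → ℕ → ℕ → Set
  Large n a b = ∃ λ r → n ≤ r × Record a b r

  climb : ∀ {a n} → (∀ b → Mark a b 0 → Large n a b) → ∀ d b → Mark a (d + b) 0 → Large n a b
  climb large zero b m = large b m
  climb {a} {n} large (suc d) b m with em {∃ (P a b)}
  ... | no ¬p = large b λ c p → ¬p (c , p)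
  ... | yes (c₀ , p₀)
    with c , mark ← least c₀ p₀
    with r , n≤r , p ← climb large d (suc b) (subst (λ b → Mark a b 0) (sym (+-suc d b)) m) =
    suc (pair (suc c) r) , ≤-trans n≤r (≤-trans (y≤pair (suc c) r) (n≤1+n _)) ,
    move (fst-pair (suc c) r) mark (subst (Record a (suc b)) (sym (snd-pair (suc c) r)) p)

  -- Every increase of `a` adds an entry, and hence at least one to the code, so a record with `n`
  -- increases is at least `n`.
  unbounded : (∀ a → ∃ λ b → Mark a b 0) → ∀ n a → Large n a 0
  unbounded marks n a with b , m ← marks a =
    climb (large n) b 0 (subst (λ b → Mark a b 0) (sym (+-identityʳ b)) m)
    where
      large : ∀ n b → Mark a b 0 → Large n a b
      large zero    b m = 0 , z≤n , end m
      large (suc n) b m with r , n≤r , p ← unbounded marks n (suc a) =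
        suc (pair 0 r) , s≤s (≤-trans n≤r (y≤pair 0 r)) ,
        skip (fst-pair 0 r) m (subst (Record (suc a) 0) (sym (snd-pair 0 r)) p)

  Bounded⇔ : Bounded 0 0 ⇔ (∃ λ a → ∀ b → ∃ (P a b))
  Bounded⇔ = to , from
    where
      to : Bounded 0 0 → ∃ λ a → ∀ b → ∃ (P a b)
      to (N , bound) = double-negation λ ¬q →
        let r , N<r , p = unbounded (λ a → marks a λ q → ¬q (a , q)) (suc N) 0
        in contradiction (bound r p) (<⇒≱ N<r)
        where
          marks : ∀ a → ¬ (∀ b → ∃ (P a b)) → ∃ λ b → Mark a b 0
          marks a ¬q with b , ¬p ← ¬∀⇒∃¬ ¬q = b , λ c p → ¬p (c , p)
      from : (∃ λ a → ∀ b → ∃ (P a b)) → Bounded 0 0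
      from (a , q) = stops⇒Bounded (λ b m → m (proj₁ (q b)) (proj₂ (q b))) a 0 (+-identityʳ a) 0

-- For each n there are the main language (i = 0) and one language i = k + 1 per k.  If
-- V n k is all of ℕ, then the latter equals the main language.  Otherwise the last w in
-- V n k yields an element (k , w + 1) of the latter that no other language contains, while
-- it agrees with the main language up to k.  The element 0 keeps the languages of different
-- n apart.
Family : (ℕ → ℕ → ℕ → Set) → ℕ → ℕ → ℕ → ℕ → Set
Family V n zero    n′ z = n′ ≡ n × V n (fst z) (snd z)
Family V n (suc k) n′ z =
  n′ ≡ n × ((V n (fst z) (snd z) × (z ≤ k ⊎ V n k z)) ⊎ (fst z ≡ k × V n k (pred (snd z))))

-- Which languages of the family have finite positive teaching sets

module Gadget
  (em : ExcludedMiddle 0ℓ) (V : ℕ → ℕ → ℕ → Set)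
  (V-zero : ∀ n k → V n k 0)
  (V-down : ∀ n k {w w′} → w ≤ w′ → V n k w′ → V n k w)
  (V-mono : ∀ n w {k k′} → k ≤ k′ → V n k w → V n k′ w)
  (e : ℕ) (L⇔ : ∀ j y → L e j y ⇔ Family V (fst j) (snd j) (fst y) (snd y))
  where

  open Classical em

  Total : ℕ → ℕ → Set
  Total n k = ∀ w → V n k w

  Bad : ℕ → Set
  Bad n = ∀ k → ¬ Total n k

  main : ℕ → ℕ
  main n = pair n 0

  main⇔ : ∀ n y → L e (main n) y ⇔ Family V n 0 (fst y) (snd y)
  main⇔ n y = ⇔-trans (L⇔ (main n) y)
    (≡⇒⇔ (cong₂ (λ n i → Family V n i (fst y) (snd y)) (fst-pair n 0) (snd-pair n 0)))

  at : ∀ n i n′ z → Family V n i (fst (pair n′ z)) (snd (pair n′ z)) ⇔ Family V n i n′ z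
  at n i n′ z = ≡⇒⇔ (cong₂ (Family V n i) (fst-pair n′ z) (snd-pair n′ z))

  family-tag : ∀ {n i n′ z} → Family V n i n′ z → n′ ≡ n
  family-tag {i = zero}  = proj₁
  family-tag {i = suc k} = proj₁

  zero∈ : ∀ n i → Family V n i n 0
  zero∈ n zero    = refl , V-zero n 0
  zero∈ n (suc k) = refl , inj₁ (V-zero n 0 , inj₁ z≤n)

  last : ∀ {n k} → ¬ Total n k → ∃ λ w → V n k w × ¬ V n k (suc w)
  last {n} {k} ¬total with w , ¬v ← ¬∀⇒∃¬ ¬total = go w ¬v
    where
      go : ∀ w → ¬ V n k w → ∃ λ w → V n k w × ¬ V n k (suc w)
      go zero ¬v = contradiction (V-zero n k) ¬v
      go (suc w) ¬v with em {V n k w}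
      ... | yes v = w , v , ¬v
      ... | no ¬v′ = go w ¬v′

  total⇒main : ∀ {n k n′ z} → Total n k → Family V n (suc k) n′ z ⇔ Family V n 0 n′ z
  total⇒main {n} {k} {n′} {z} total = to , from
    where
      to : Family V n (suc k) n′ z → Family V n 0 n′ z
      to (eq , inj₁ (v , _)) = eq , v
      to (eq , inj₂ (refl , _)) = eq , total (snd z)
      from : Family V n 0 n′ z → Family V n (suc k) n′ z
      from (eq , v) = eq , inj₁ (v , inj₂ (total z))

  total⇒L≐main : ∀ j {k} → snd j ≡ suc k → Total (fst j) k → L e j ≐ L e (main (fst j))
  total⇒L≐main j {k} eq total y =
    ⇔-trans (L⇔ j y) (⇔-trans (≡⇒⇔ (cong (λ i → Family V (fst j) i (fst y) (snd y)) eq))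
      (⇔-trans (total⇒main total) (⇔-sym (main⇔ (fst j) y))))

  private-element : ∀ {n k i n′ w} → ¬ V n k (suc w) → Family V n′ i n (pair k (suc w)) → n ≡ n′ × i ≡ suc k
  private-element {k = k} {zero} {w = w} ¬v (refl , v)
    rewrite fst-pair k (suc w) | snd-pair k (suc w) = contradiction v ¬v
  private-element {k = k} {suc k′} {w = w} ¬v (refl , inj₁ (v , _))
    rewrite fst-pair k (suc w) | snd-pair k (suc w) = contradiction v ¬v
  private-element {k = k} {suc k′} {w = w} ¬v (refl , inj₂ (eq , _)) =
    refl , cong suc (trans (sym eq) (fst-pair k (suc w)))

  nontotal⇒TD : ∀ j {k} → snd j ≡ suc k → ¬ Total (fst j) k → TD⁺Finite e j
  nontotal⇒TD j {k} eq ¬total with w , v , ¬v ← last ¬total =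
    pair n z ∷ [] , (proj₂ (L⇔ j (pair n z)) (proj₂ (at n (snd j) n z) member) ∷ []) , unique
    where
      n z : ℕ
      n = fst j
      z = pair k (suc w)
      member : Family V n (snd j) n z
      member rewrite eq = refl , inj₂ (fst-pair k (suc w) , subst (λ u → V n k (pred u)) (sym (snd-pair k (suc w))) v)
      unique : ¬ (∃ λ j′ → ¬ (L e j′ ≐ L e j) × ((pair n z ∷ []) ⊆ₗ L e j′))
      unique (j′ , L≢ , l ∷ [])
        with n≡ , i≡ ← private-element {w = w} ¬v (proj₁ (at (fst j′) (snd j′) n z) (proj₁ (L⇔ j′ (pair n z)) l)) =
        L≢ (subst (λ j′ → L e j′ ≐ L e j)
             (trans (sym (pair-fst-snd j)) (trans (cong₂ pair n≡ (trans eq (sym i≡))) (pair-fst-snd j′)))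
             (λ _ → ⇔-refl))

  -- A w beyond every V n k with k < k* that is not total gives an element (k* , w + k*) of
  -- the main language that is missing from the corresponding languages.
  total⇒TD : ∀ n {k*} → Total n k* → TD⁺Finite e (main n)
  total⇒TD n {k*} total =
    pair n z ∷ [] , (proj₂ (main⇔ n (pair n z)) (proj₂ (at n 0 n z) (refl , z∈main)) ∷ []) , unique
    where
      Beyond : ℕ → ℕ → Set
      Beyond k w = ¬ Total n k → ¬ V n k w
      beyond : ∃ λ w → ∀ k → k < k* → Beyond k w
      beyond = bounded-choice (λ {k} w≤w′ b ¬total v → b ¬total (V-down n k w≤w′ v)) k* (λ k _ → witness k)
        where
          witness : ∀ k → ∃ (Beyond k)
          witness k with em {Total n k}
          ... | yes total = 0 , λ ¬total → contradiction total ¬total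
          ... | no ¬total with w , ¬v ← ¬∀⇒∃¬ ¬total = w , λ _ → ¬v
      w z : ℕ
      w = proj₁ beyond
      z = pair k* (w + k*)
      z∈main : V n (fst z) (snd z)
      z∈main = subst (λ k → V n k (snd z)) (sym (fst-pair k* (w + k*))) (total (snd z))
      total-if-z∈ : ∀ {n′ k} → Family V n′ (suc k) n z → Total n′ k
      total-if-z∈ {k = k} (refl , p) with k <? k*
      -- By monotonicity every column from `k*` on is total, so the languages belonging to them
      -- coincide with the main one.
      ... | no k≮k* = λ w → V-mono n w (≮⇒≥ k≮k*) (total w)
      ... | yes k<k* = double-negation λ ¬total → cases ¬total p
        where
          cases : ¬ Total n k → (V n (fst z) (snd z) × (z ≤ k ⊎ V n k z)) ⊎ (fst z ≡ k × V n k (pred (snd z))) → ⊥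
          cases ¬total (inj₁ (_ , inj₁ z≤k)) = <⇒≱ k<k* (≤-trans (x≤pair k* (w + k*)) z≤k)
          cases ¬total (inj₁ (_ , inj₂ v)) =
            proj₂ beyond k k<k* ¬total (V-down n k (≤-trans (m≤m+n w k*) (y≤pair k* (w + k*))) v)
          cases ¬total (inj₂ (eq , _)) = <⇒≢ k<k* (trans (sym eq) (fst-pair k* (w + k*)))
      L≐ : ∀ j → Family V (fst j) (snd j) n z → L e j ≐ L e (main n)
      L≐ j f with snd j in eq
      ... | zero = subst (λ i → L e i ≐ L e (main n))
                     (trans (cong₂ pair (family-tag {i = 0} {z = z} f) (sym eq)) (pair-fst-snd j)) (λ _ → ⇔-refl)
      ... | suc k = subst (λ n → L e j ≐ L e (main n))
                      (sym (family-tag {i = suc k} {z = z} f)) (total⇒L≐main j eq (total-if-z∈ f))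
      unique : ¬ (∃ λ j → ¬ (L e j ≐ L e (main n)) × ((pair n z ∷ []) ⊆ₗ L e j))
      unique (j , L≢ , l ∷ []) =
        L≢ (L≐ j (proj₁ (at (fst j) (snd j) n z) (proj₁ (L⇔ j (pair n z)) l)))

  -- For `k = sum S` the language `k + 1` agrees with the main one on all of `S`. As column `k` is
  -- not total, it also has a private element, so it differs from the main language and `S` fails to
  -- teach.
  Bad⇒¬TD : ∀ n → Bad n → ¬ TD⁺Finite e (main n)
  Bad⇒¬TD n bad (S , S⊆L , teaches) with w , v , ¬v ← last (bad (sum S)) =
    teaches (j , L≢ , All.tabulate λ y∈S → S⊆Lⱼ y∈S (All.lookup S⊆L y∈S))
    where
      k j z : ℕ
      k = sum S
      j = pair n (suc k)
      z = pair k (suc w)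
      j⇔ : ∀ y → L e j y ⇔ Family V n (suc k) (fst y) (snd y)
      j⇔ y = ⇔-trans (L⇔ j y)
        (≡⇒⇔ (cong₂ (λ n i → Family V n i (fst y) (snd y)) (fst-pair n (suc k)) (snd-pair n (suc k))))
      S⊆Lⱼ : ∀ {y} → y ∈ S → L e (main n) y → L e j y
      S⊆Lⱼ {y} y∈S l with eq , v ← proj₁ (main⇔ n y) l =
        proj₂ (j⇔ y) (eq , inj₁ (v , inj₁ (≤-trans (snd≤ y) (member≤sum y∈S))))
      z∈ : L e j (pair n z)
      z∈ = proj₂ (j⇔ (pair n z)) (proj₂ (at n (suc k) n z)
        (refl , inj₂ (fst-pair k (suc w) , subst (λ u → V n k (pred u)) (sym (snd-pair k (suc w))) v)))
      L≢ : ¬ (L e j ≐ L e (main n))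
      L≢ eq with () ← proj₂ (private-element {i = 0} {w = w} ¬v
        (proj₁ (at n 0 n z) (proj₁ (main⇔ n (pair n z)) (proj₁ (eq (pair n z)) z∈))))

  TD-resp-≐ : ∀ j k → L e j ≐ L e k → TD⁺Finite e k → TD⁺Finite e j
  TD-resp-≐ j k eq (S , S⊆L , teaches) =
    S , All.map (λ {y} → proj₂ (eq y)) S⊆L ,
    λ { (i , L≢ , S⊆) → teaches (i , (λ eq′ → L≢ (≐-trans eq′ (≐-sym eq))) , S⊆) }

  I⇔ : I-TD⁺ e ⇔ (∃ λ N → ∀ n → Bad n → n ≤ N)
  I⇔ = to , from
    where
      to : I-TD⁺ e → ∃ λ N → ∀ n → Bad n → n ≤ N
      to (F , p) = sum F , bound
        where
          bound : ∀ n → Bad n → n ≤ sum F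
          bound n bad with k , k∈F , eq ← find (p (main n) (Bad⇒¬TD n bad)) =
            ≤-trans (subst (_≤ k) (sym n≡) (fst≤ k)) (member≤sum k∈F)
            where
              -- `pair n 0` lies in all languages of block `n` and in no others, so any index of the
              -- main language reveals `n`.
              n≡ : n ≡ fst k
              n≡ = family-tag {i = snd k} (proj₁ (at (fst k) (snd k) n 0) (proj₁ (L⇔ k (pair n 0))
                (proj₁ (eq (pair n 0)) (proj₂ (main⇔ n (pair n 0)) (proj₂ (at n 0 n 0) (zero∈ n 0))))))
      from : (∃ λ N → ∀ n → Bad n → n ≤ N) → I-TD⁺ e
      from (N , bound) = map main (upTo (suc N)) , member
        where
          member : ∀ j → ¬ TD⁺Finite e j → Any (λ k → L e j ≐ L e k) (map main (upTo (suc N)))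
          member j ¬td with snd j in eq
          ... | suc k with em {Total (fst j) k}
          ...   | yes total = contradiction (TD-resp-≐ j (main (fst j)) (total⇒L≐main j eq total) (total⇒TD (fst j) total)) ¬td
          ...   | no ¬total = contradiction (nontotal⇒TD j eq ¬total) ¬td
          member j ¬td | zero = lose (∈-map⁺ main (∈-upTo⁺ (s≤s (bound (fst j) bad)))) L≐
            where
              j≡ : j ≡ main (fst j)
              j≡ = trans (sym (pair-fst-snd j)) (cong (pair (fst j)) eq)
              L≐ : L e j ≐ L e (main (fst j))
              L≐ = subst (λ k → L e j ≐ L e k) j≡ (λ _ → ⇔-refl)
              bad : Bad (fst j)
              bad k total = ¬td (TD-resp-≐ j (main (fst j)) L≐ (total⇒TD (fst j) total))

-- Recursive tests for the family

-- With 0 for true, products express bounded existential quantifiers as sums express bounded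
-- universal ones.
prodTo : (ℕ → ℕ) → ℕ → ℕ
prodTo f = natrec 1 (λ i w → f i * w)

prodTo-intro : ∀ {f} n → (∃ λ i → i < n × f i ≡ 0) → prodTo f n ≡ 0
prodTo-intro {f} (suc n) (i , i<1+n , eq) with m<1+n⇒m<n∨m≡n i<1+n
... | inj₁ i<n  = trans (cong (f n *_) (prodTo-intro {f} n (i , i<n , eq))) (*-zeroʳ (f n))
... | inj₂ refl = cong (_* prodTo f n) eq

prodTo-elim : ∀ {f} n → prodTo f n ≡ 0 → ∃ λ i → i < n × f i ≡ 0
prodTo-elim {f} (suc n) eq with m*n≡0⇒m≡0∨n≡0 (f n) eq
... | inj₁ eq₁ = n , ≤-refl , eq₁
... | inj₂ eq₂ with i , i<n , eq₃ ← prodTo-elim {f} n eq₂ = i , m<n⇒m<1+n i<n , eq₃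

distance : ℕ → ℕ → ℕ
distance m n = (m ∸ n) + (n ∸ m)

distance≡0 : ∀ m n → (distance m n ≡ 0) ⇔ (m ≡ n)
distance≡0 m n = to , from
  where
    to : distance m n ≡ 0 → m ≡ n
    to eq = ≤-antisym (m∸n≡0⇒m≤n (m+n≡0⇒m≡0 (m ∸ n) eq)) (m∸n≡0⇒m≤n (m+n≡0⇒n≡0 (m ∸ n) eq))
    from : m ≡ n → distance m n ≡ 0
    from refl = cong₂ _+_ (n∸n≡0 m) (n∸n≡0 m)

state : ℕ → ℕ → ℕ → ℕ
state a b r = pair (pair a b) r

-- An exhausted record leaves the state unchanged, so one may quantify over all times without
-- knowing the length of the record.
advanceFrom : ℕ → ℕ → ℕ → ℕ
advanceFrom a b r = ifz r (state a b r)
  (ifz (fst (pred r)) (state (suc a) 0 (snd (pred r))) (state a (suc b) (snd (pred r))))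

advance : ℕ → ℕ
advance q = advanceFrom (fst (fst q)) (snd (fst q)) (snd q)

trace : ℕ → ℕ → ℕ
trace q = natrec q (λ _ → advance)

-- An exhausted record claims mark 0, as `end` demands.
mark : ℕ → ℕ
mark r = ifz r 0 (fst (pred r))

trace-comp : Comp 2 trace
trace-comp = by
  (rec′ #0
    (let q = #0; a = fst′ (fst′ q); b = snd′ (fst′ q); r = snd′ q; p = pred′ r in
     ifz′ r (pair′ (pair′ a b) r)
       (ifz′ (fst′ p) (pair′ (pair′ (suc′ a) (lit 0)) (snd′ p)) (pair′ (pair′ a (suc′ b)) (snd′ p))))
    #1)
  λ { (_ ∷ _ ∷ []) → refl }

state-a : ∀ a b r → fst (fst (state a b r)) ≡ a
state-a a b r = trans (cong fst (fst-pair (pair a b) r)) (fst-pair a b)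

state-b : ∀ a b r → snd (fst (state a b r)) ≡ b
state-b a b r = trans (cong snd (fst-pair (pair a b) r)) (snd-pair a b)

state-r : ∀ a b r → snd (state a b r) ≡ r
state-r a b r = snd-pair (pair a b) r

advance-state : ∀ a b r → advance (state a b r) ≡ advanceFrom a b r
advance-state a b r = cong₃ advanceFrom (state-a a b r) (state-b a b r) (state-r a b r)

advance-skip : ∀ a b r → fst r ≡ 0 → advance (state a b (suc r)) ≡ state (suc a) 0 (snd r)
advance-skip a b r eq = trans (advance-state a b (suc r))
  (cong (λ m → ifz m (state (suc a) 0 (snd r)) (state a (suc b) (snd r))) eq)

advance-move : ∀ a b r {c} → fst r ≡ suc c → advance (state a b (suc r)) ≡ state a (suc b) (snd r)
advance-move a b r eq = trans (advance-state a b (suc r))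
  (cong (λ m → ifz m (state (suc a) 0 (snd r)) (state a (suc b) (snd r))) eq)

trace-suc : ∀ q i → trace q (suc i) ≡ trace (advance q) i
trace-suc q zero    = refl
trace-suc q (suc i) = cong advance (trace-suc q i)

module Tests (R : Fun 6) (R-comp : Comp 6 R) where

  -- For m = 0, refuting Mark a b 0 takes a u = c with P a b c.  Refuting Mark a b (c + 1)
  -- takes either a u < c with P a b u, or a u = c + d such that d refutes P a b c.
  query : ℕ → ℕ → ℕ → ℕ → ℕ → ℕ → ℕ → ℕ
  query x a b m u d s = ifz m (R x a b u d s) (ifz (suc u ∸ pred m)
    (R x a b u d s) (ifz (R x a b (pred m) (u ∸ pred m) d) 1 0))

  queryAt : ℕ → ℕ → ℕ → ℕ → ℕ → ℕ
  queryAt x q u d s = query x (fst (fst q)) (snd (fst q)) (mark (snd q)) u d s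

  allSome : ℕ → ℕ → ℕ → ℕ → ℕ → ℕ
  allSome x q u w t = sumTo (λ d → prodTo (λ s → queryAt x q u d s) t) w

  -- V n k w says that some pair i u ≤ k satisfies ∀ d < w. ∃ s. queryAt x q u d s ≡ 0 at
  -- the i-th state q of the record n.
  vTest : ℕ → ℕ → ℕ → ℕ → ℕ → ℕ → ℕ
  vTest x n k w K t = (K ∸ k) + allSome x (trace (state 0 0 n) (fst K)) (snd K) w t

  V : ℕ → ℕ → ℕ → ℕ → Set
  V x n k w = ∃ λ p → vTest x n k w (fst p) (snd p) ≡ 0

  -- Here `+` is conjunction and `*` disjunction. `p` codes two witnesses because one alternative of
  -- `Family` needs two instances of `V`.
  memberTest : ℕ → ℕ → ℕ → ℕ → ℕ → ℕ → ℕ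
  memberTest x n i n′ z p = distance n′ n + ifz i (v (fst z) (snd z) (fst p))
    ((v (fst z) (snd z) (fst p) + (z ∸ pred i) * v (pred i) z (snd p))
      * (distance (fst z) (pred i) + v (pred i) (pred (snd z)) (fst p)))
    where
      v : ℕ → ℕ → ℕ → ℕ
      v k w p = vTest x n k w (fst p) (snd p)

  languageTest : ℕ → ℕ → ℕ → ℕ
  languageTest x u p = memberTest x (fst (fst u)) (snd (fst u)) (fst (snd u)) (snd (snd u)) p

  query-comp : Comp 7 query
  query-comp = by
    (let x = #0; a = #1; b = #2; m = #3; u = #4; d = #5; s = #6; c = pred′ m
         r : Exp 7
         r = call R-comp (x ∷ a ∷ b ∷ u ∷ d ∷ s ∷ []) in
     ifz′ m r (ifz′ (suc′ u ∸′ c) r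
       (ifz′ (call R-comp (x ∷ a ∷ b ∷ c ∷ (u ∸′ c) ∷ d ∷ [])) (lit 1) (lit 0))))
    λ { (_ ∷ _ ∷ _ ∷ _ ∷ _ ∷ _ ∷ _ ∷ []) → refl }

  queryAt-comp : Comp 5 queryAt
  queryAt-comp = by
    (let x = #0; q = #1; u = #2; d = #3; s = #4; r = snd′ q in
     call query-comp (x ∷ fst′ (fst′ q) ∷ snd′ (fst′ q) ∷ ifz′ r (lit 0) (fst′ (pred′ r)) ∷ u ∷ d ∷ s ∷ []))
    λ { (_ ∷ _ ∷ _ ∷ _ ∷ _ ∷ []) → refl }

  allSome-comp : Comp 5 allSome
  allSome-comp = by
    (rec′ (lit 0)
      (rec′ (lit 1)
        (let s = #1; d = #3; x = #4; q = #5; u = #6 in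
         call queryAt-comp (x ∷ q ∷ u ∷ d ∷ s ∷ []) *′ #0)
        #6 +′ #0)
      #3)
    λ { (_ ∷ _ ∷ _ ∷ _ ∷ _ ∷ []) → refl }

  vTest-comp : Comp 6 vTest
  vTest-comp = by
    (let x = #0; n = #1; k = #2; w = #3; K = #4; t = #5 in
     (K ∸′ k) +′ call allSome-comp
       (x ∷ call trace-comp (pair′ (pair′ (lit 0) (lit 0)) n ∷ fst′ K ∷ []) ∷ snd′ K ∷ w ∷ t ∷ []))
    λ { (_ ∷ _ ∷ _ ∷ _ ∷ _ ∷ _ ∷ []) → refl }

  distance′ : ∀ {n} → Exp n → Exp n → Exp n
  distance′ d e = (d ∸′ e) +′ (e ∸′ d)

  memberTest-comp : Comp 6 memberTest
  memberTest-comp = by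
    (let x = #0; n = #1; i = #2; n′ = #3; z = #4; p = #5
         v : Exp 6 → Exp 6 → Exp 6 → Exp 6
         v = λ k w p → call vTest-comp (x ∷ n ∷ k ∷ w ∷ fst′ p ∷ snd′ p ∷ []) in
     distance′ n′ n +′ ifz′ i (v (fst′ z) (snd′ z) (fst′ p))
       ((v (fst′ z) (snd′ z) (fst′ p) +′ (z ∸′ pred′ i) *′ v (pred′ i) z (snd′ p))
         *′ (distance′ (fst′ z) (pred′ i) +′ v (pred′ i) (pred′ (snd′ z)) (fst′ p))))
    λ { (_ ∷ _ ∷ _ ∷ _ ∷ _ ∷ _ ∷ []) → refl }

  languageTest-comp : Comp 3 languageTest
  languageTest-comp = by
    (let x = #0; u = #1; p = #2 in
     call memberTest-comp (x ∷ fst′ (fst′ u) ∷ snd′ (fst′ u) ∷ fst′ (snd′ u) ∷ snd′ (snd′ u) ∷ p ∷ []))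
    λ { (_ ∷ _ ∷ _ ∷ []) → refl }

  Hit : ℕ → ℕ → ℕ → ℕ → Set
  Hit x q u d = ∃ λ s → queryAt x q u d s ≡ 0

  allSome⇔ : ∀ x q u w t → (allSome x q u w t ≡ 0) ⇔
             (∀ d → d < w → ∃ λ s → s < t × queryAt x q u d s ≡ 0)
  allSome⇔ x q u w t =
    (λ eq d d<w → prodTo-elim {queryAt x q u d} t (sumTo-elim {f} w eq d d<w)) ,
    (λ p → sumTo-intro {f} w λ d d<w → prodTo-intro {queryAt x q u d} t (p d d<w))
    where
      f : ℕ → ℕ
      f d = prodTo (queryAt x q u d) t

  V⇔ : ∀ x n k w → V x n k w ⇔
       (∃ λ K → K ≤ k × (∀ d → d < w → Hit x (trace (state 0 0 n) (fst K)) (snd K) d))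
  V⇔ x n k w = to , from
    where
      q : ℕ → ℕ
      q K = trace (state 0 0 n) (fst K)
      to : V x n k w → ∃ λ K → K ≤ k × (∀ d → d < w → Hit x (q K) (snd K) d)
      to (p , eq) = K , m∸n≡0⇒m≤n (m+n≡0⇒m≡0 (K ∸ k) eq) , λ d d<w →
        let s , _ , hit = proj₁ (allSome⇔ x (q K) (snd K) w (snd p)) (m+n≡0⇒n≡0 (K ∸ k) eq) d d<w in s , hit
        where
          K : ℕ
          K = fst p
      from : (∃ λ K → K ≤ k × (∀ d → d < w → Hit x (q K) (snd K) d)) → V x n k w
      from (K , K≤k , hits) with t , within ← bounded-choice
          {λ d t → ∃ λ s → s < t × queryAt x (q K) (snd K) d s ≡ 0}
          (λ { t≤t′ (s , s<t , hit) → s , ≤-trans s<t t≤t′ , hit }) w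
          (λ d d<w → let s , hit = hits d d<w in suc s , s , ≤-refl , hit) =
        pair K t , trans (cong₂ (vTest x n k w) (fst-pair K t) (snd-pair K t))
          (cong₂ _+_ (m≤n⇒m∸n≡0 K≤k) (proj₂ (allSome⇔ x (q K) (snd K) w t) within))

  V-zero : ∀ x n k → V x n k 0
  V-zero x n k = proj₂ (V⇔ x n k 0) (0 , z≤n , λ _ ())

  V-down : ∀ x n k {w w′} → w ≤ w′ → V x n k w′ → V x n k w
  V-down x n k {w} {w′} w≤w′ v with K , K≤k , hits ← proj₁ (V⇔ x n k w′) v =
    proj₂ (V⇔ x n k w) (K , K≤k , λ d d<w → hits d (≤-trans d<w w≤w′))

  V-mono : ∀ x n w {k k′} → k ≤ k′ → V x n k w → V x n k′ w
  V-mono x n w {k} {k′} k≤k′ v with K , K≤k , hits ← proj₁ (V⇔ x n k w) v =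
    proj₂ (V⇔ x n k′ w) (K , ≤-trans K≤k k≤k′ , hits)

  family⇔ : ∀ x n i n′ z → (∃ λ p → memberTest x n i n′ z p ≡ 0) ⇔ Family (V x) n i n′ z
  family⇔ x n zero n′ z = to , from
    where
      to : (∃ λ p → memberTest x n 0 n′ z p ≡ 0) → Family (V x) n 0 n′ z
      to (p , eq) = proj₁ (distance≡0 n′ n) (m+n≡0⇒m≡0 (distance n′ n) eq) ,
                    fst p , m+n≡0⇒n≡0 (distance n′ n) eq
      from : Family (V x) n 0 n′ z → ∃ λ p → memberTest x n 0 n′ z p ≡ 0
      from (n≡ , p , v) = pair p 0 , cong₂ _+_ (proj₂ (distance≡0 n′ n) n≡)
        (trans (cong (λ p → vTest x n (fst z) (snd z) (fst p) (snd p)) (fst-pair p 0)) v)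
  family⇔ x n (suc k) n′ z = to , from
    where
      v : ℕ → ℕ → ℕ → ℕ
      v k w p = vTest x n k w (fst p) (snd p)
      left right : ℕ → ℕ → ℕ
      left p p′ = v (fst z) (snd z) p + (z ∸ k) * v k z p′
      right p p′ = distance (fst z) k + v k (pred (snd z)) p
      to : (∃ λ p → memberTest x n (suc k) n′ z p ≡ 0) → Family (V x) n (suc k) n′ z
      to (p , eq) = proj₁ (distance≡0 n′ n) (m+n≡0⇒m≡0 (distance n′ n) eq) ,
                    cases (m*n≡0⇒m≡0∨n≡0 (left (fst p) (snd p)) (m+n≡0⇒n≡0 (distance n′ n) eq))
        where
          cases : left (fst p) (snd p) ≡ 0 ⊎ right (fst p) (snd p) ≡ 0 →
                  (V x n (fst z) (snd z) × (z ≤ k ⊎ V x n k z)) ⊎ (fst z ≡ k × V x n k (pred (snd z)))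
          cases (inj₁ eq) with m*n≡0⇒m≡0∨n≡0 (z ∸ k) (m+n≡0⇒n≡0 (v (fst z) (snd z) (fst p)) eq)
          ... | inj₁ z∸k≡0 = inj₁ ((fst p , m+n≡0⇒m≡0 _ eq) , inj₁ (m∸n≡0⇒m≤n z∸k≡0))
          ... | inj₂ v≡0   = inj₁ ((fst p , m+n≡0⇒m≡0 _ eq) , inj₂ (snd p , v≡0))
          cases (inj₂ eq) = inj₂ (proj₁ (distance≡0 (fst z) k) (m+n≡0⇒m≡0 (distance (fst z) k) eq) ,
                                  fst p , m+n≡0⇒n≡0 (distance (fst z) k) eq)
      witness : ∀ p p′ → n′ ≡ n → left p p′ * right p p′ ≡ 0 → ∃ λ p → memberTest x n (suc k) n′ z p ≡ 0
      witness p p′ n≡ eq = pair p p′ , cong₂ _+_ (proj₂ (distance≡0 n′ n) n≡)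
        (trans (cong₂ (λ p p′ → left p p′ * right p p′) (fst-pair p p′) (snd-pair p p′)) eq)
      from : Family (V x) n (suc k) n′ z → ∃ λ p → memberTest x n (suc k) n′ z p ≡ 0
      from (n≡ , inj₁ ((p , v≡0) , inj₁ z≤k)) = witness p 0 n≡
        (cong (_* right p 0) (cong₂ _+_ v≡0 (cong (_* v k z 0) (m≤n⇒m∸n≡0 z≤k))))
      from (n≡ , inj₁ ((p , v≡0) , inj₂ (p′ , v′≡0))) = witness p p′ n≡
        (cong (_* right p p′) (cong₂ _+_ v≡0 (trans (cong ((z ∸ k) *_) v′≡0) (*-zeroʳ (z ∸ k)))))
      from (n≡ , inj₂ (k≡ , p , v≡0)) = witness p 0 n≡
        (trans (cong (left p 0 *_) (cong₂ _+_ (proj₂ (distance≡0 (fst z) k) k≡) v≡0)) (*-zeroʳ (left p 0)))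

  language⇔ : ∀ x j y → (∃ λ p → languageTest x (pair j y) p ≡ 0) ⇔
                        Family (V x) (fst j) (snd j) (fst y) (snd y)
  language⇔ x j y = ⇔-trans
    (∃-cong λ p → ≡⇒⇔ (cong₂ (λ j y → memberTest x (fst j) (snd j) (fst y) (snd y) p ≡ 0)
                        (fst-pair j y) (snd-pair j y)))
    (family⇔ x (fst j) (snd j) (fst y) (snd y))

-- Correctness of the reduction

module Reduction (em : ExcludedMiddle 0ℓ) (R : Fun 6) (R-comp : Comp 6 R) (x : ℕ) where

  open Classical em
  open Tests R R-comp

  P : ℕ → ℕ → ℕ → Set
  P a b c = ∀ d → ∃ λ s → R x a b c d s ≡ 0

  open Search em P

  Consistent : ℕ → Set
  Consistent q = ¬ (∃ λ u → ∀ d → Hit x q u d)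

  -- To refute `P a b c` is to find a `d` such that `R` is nonzero for all `s`. In `query` the sum
  -- `c + d` is the existential variable `u`, and the universal variable stands for that `s`.
  query-zero⇔Mark : ∀ a b m → (¬ (∃ λ u → ∀ d → ∃ λ s → query x a b m u d s ≡ 0)) ⇔ Mark a b m
  query-zero⇔Mark a b zero = (λ ¬q c p → ¬q (c , p)) , (λ { ¬p (c , p) → ¬p c p })
  query-zero⇔Mark a b (suc c) = to , from
    where
      to : ¬ (∃ λ u → ∀ d → ∃ λ s → query x a b (suc c) u d s ≡ 0) → Mark a b (suc c)
      to ¬q = double-negation (λ ¬p → refuted (¬∀⇒∃¬ ¬p)) , λ c′ c′<c p → ¬q (c′ , smaller c′ c′<c p)
        where
          refuted : ¬ (∃ λ d → ¬ (∃ λ s → R x a b c d s ≡ 0))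
          refuted (d , ¬r) = ¬q (c + d , λ s → 0 , value s)
            where
              value : ∀ s → query x a b (suc c) (c + d) s 0 ≡ 0
              value s rewrite +-∸-assoc 1 (m≤m+n c d) | m+n∸m≡n c d with R x a b c d s in eq
              ... | zero  = contradiction (s , eq) ¬r
              ... | suc _ = refl
          smaller : ∀ c′ → c′ < c → P a b c′ → ∀ d → ∃ λ s → query x a b (suc c) c′ d s ≡ 0
          smaller c′ c′<c p d with s , eq ← p d rewrite m≤n⇒m∸n≡0 c′<c = s , eq
      from : Mark a b (suc c) → ¬ (∃ λ u → ∀ d → ∃ λ s → query x a b (suc c) u d s ≡ 0)
      from (p , below) (u , q) with suc u ∸ c in eq
      ... | zero = below u (m∸n≡0⇒m≤n eq) q
      ... | suc _ with s , r ← p (u ∸ c) with _ , q′ ← q s rewrite r with () ← q′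

  consistent⇔Mark : ∀ a b r → Consistent (state a b r) ⇔ Mark a b (mark r)
  consistent⇔Mark a b r = ⇔-trans
    (≡⇒⇔ (cong₃ (λ a b r → ¬ (∃ λ u → ∀ d → ∃ λ s → query x a b (mark r) u d s ≡ 0))
           (state-a a b r) (state-b a b r) (state-r a b r)))
    (query-zero⇔Mark a b (mark r))

  ConsistentFrom : ℕ → Set
  ConsistentFrom q = ∀ i → Consistent (trace q i)

  consistent-∷ : ∀ q {q′} → advance q ≡ q′ → Consistent q → ConsistentFrom q′ → ConsistentFrom q
  consistent-∷ q refl c cs zero = c
  consistent-∷ q refl c cs (suc i) = subst Consistent (sym (trace-suc q i)) (cs i)

  consistent-tail : ∀ q {q′} → advance q ≡ q′ → ConsistentFrom q → ConsistentFrom q′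
  consistent-tail q refl cs i = subst Consistent (trace-suc q i) (cs (suc i))

  record⇒consistent : ∀ {a b r} → Record a b r → ConsistentFrom (state a b r)
  record⇒consistent {a} {b} (end m) i =
    subst Consistent (sym (constant i)) (proj₂ (consistent⇔Mark a b 0) m)
    where
      constant : ∀ i → trace (state a b 0) i ≡ state a b 0
      constant zero    = refl
      constant (suc i) = trans (cong advance (constant i)) (advance-state a b 0)
  record⇒consistent {a} {b} (skip {r} eq m p) = consistent-∷ (state a b (suc r)) (advance-skip a b r eq)
    (proj₂ (consistent⇔Mark a b (suc r)) (subst (Mark a b) (sym eq) m)) (record⇒consistent p)
  record⇒consistent {a} {b} (move {r} eq m p) = consistent-∷ (state a b (suc r)) (advance-move a b r eq)
    (proj₂ (consistent⇔Mark a b (suc r)) (subst (Mark a b) (sym eq) m)) (record⇒consistent p)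

  -- `n` bounds the code, since the tail `snd r` is smaller as a number but not a subterm.
  consistent⇒record : ∀ n {a b} r → r < n → ConsistentFrom (state a b r) → Record a b r
  consistent⇒record (suc n) {a} {b} zero _ cs = end (proj₁ (consistent⇔Mark a b 0) (cs 0))
  consistent⇒record (suc n) {a} {b} (suc r) (s≤s r<n) cs = split (fst r) refl
    where
      m : Mark a b (fst r)
      m = proj₁ (consistent⇔Mark a b (suc r)) (cs 0)
      split : ∀ c → fst r ≡ c → Record a b (suc r)
      split zero eq = skip eq (subst (Mark a b) eq m)
        (consistent⇒record n (snd r) (≤-<-trans (snd≤ r) r<n)
          (consistent-tail (state a b (suc r)) (advance-skip a b r eq) cs))
      split (suc c) eq = move eq (subst (Mark a b) eq m)
        (consistent⇒record n (snd r) (≤-<-trans (snd≤ r) r<n)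
          (consistent-tail (state a b (suc r)) (advance-move a b r eq) cs))

  -- A refutation `u` of the `i`-th state makes column `pair i u` total. Conversely, if nothing is
  -- refuted, each of the finitely many `K ≤ k` misses some `d`, and a `D` above all these keeps
  -- column `k` from being total.
  bad⇔record : ∀ n → (∀ k → ¬ (∀ w → V x n k w)) ⇔ Record 0 0 n
  bad⇔record n = (λ bad → consistent⇒record (suc n) n ≤-refl (to bad)) ,
                 (λ p → from (record⇒consistent p))
    where
      q : ℕ → ℕ
      q = trace (state 0 0 n)
      to : (∀ k → ¬ (∀ w → V x n k w)) → ConsistentFrom (state 0 0 n)
      to bad i (u , hits) = bad K λ w → proj₂ (V⇔ x n K w) (K , ≤-refl , λ d _ →
        subst₂ (λ i u → Hit x (q i) u d) (sym (fst-pair i u)) (sym (snd-pair i u)) (hits d))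
        where
          K : ℕ
          K = pair i u
      from : ConsistentFrom (state 0 0 n) → ∀ k → ¬ (∀ w → V x n k w)
      from cs k total
        with D , missing ← bounded-choice {λ K D → ∃ λ d → d < D × ¬ Hit x (q (fst K)) (snd K) d}
          (λ { D≤D′ (d , d<D , ¬hit) → d , ≤-trans d<D D≤D′ , ¬hit }) (suc k)
          (λ K _ → let d , ¬hit = ¬∀⇒∃¬ (λ hits → cs (fst K) (snd K , hits)) in suc d , d , ≤-refl , ¬hit)
        with K , K≤k , hits ← proj₁ (V⇔ x n k D) (total D)
        with d , d<D , ¬hit ← missing K (s≤s K≤k) = ¬hit (hits d d<D)

  I⇔Σ₅ : ∀ e → (∀ z → W e z ⇔ (∃ λ p → languageTest x z p ≡ 0)) → I-TD⁺ e ⇔ Σ₅ R x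
  I⇔Σ₅ e W⇔ = ⇔-trans I⇔ (⇔-trans
    (∃-cong λ N → ∀-cong λ n →
      (λ bound p → bound (proj₂ (bad⇔record n) p)) , (λ bound bad → bound (proj₁ (bad⇔record n) bad)))
    Bounded⇔)
    where
      open Gadget em (V x) (V-zero x) (V-down x) (V-mono x) e
        (λ j y → ⇔-trans (W⇔ (pair j y)) (language⇔ x j y))

theorem10 : ExcludedMiddle 0ℓ → SigmaComplete 5 I-TD⁺
theorem10 em = Upper.I-Sigma em , reduce
  where
    reduce : ∀ B → Sigma 5 B → B ≤m I-TD⁺
    reduce B B-Sigma =
      let R , R-comp , B⇔ = Sigma⇒Σ₅ B-Sigma
          f , f-computable , W⇔ = smn (Tests.languageTest R R-comp) (Tests.languageTest-comp R R-comp)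
      in f , f-computable , λ x → ⇔-trans (B⇔ x) (⇔-sym (Reduction.I⇔Σ₅ em R R-comp x (f x) (W⇔ x)))
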